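{- Let $r$ and $n$ be nonnegative integers and let $G$ be a graph on $n$ vertices with maximum degree $\Delta(G) \le r$. Let $\vec n = (n_1, \dots, n_d)$ be a vector of positive integers with $\sum_{i=1}^d n_i = n$ such that $n_i \le \lfloor n/(r+1) \rfloor$ for all $i \in [d]$. Then there exists an $\vec n$-coloring of $G$.
   Context: Graphs are finite and simple, and $[d] = \{1,\dots,d\}$. Given a vector $\vec n = (n_1,\dots,n_d)$ of positive integers summing to $n$ (a color vector), an $\vec n$-coloring (or prescribed coloring) of a graph $G$ on $n$ vertices is a proper coloring of the vertices of $G$ with colors $1,\dots,d$ such that for each $i \in [d]$ exactly $n_i$ vertices receive color $i$. -}

module Defs where

open import Data.Fin.Base using (Fin)
open import Data.Fin.Properties using (_≟_)
open import Data.List.Extrema.Nat using (max)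
open import Data.Nat.Base using (ℕ)
open import Data.Vec.Base using (Vec; allFin; count; lookup; map; toList)
open import Level using (0ℓ)
open import Relation.Binary.Core using (Rel)
open import Relation.Binary.Definitions using (Decidable; Irreflexive; Symmetric)
open import Relation.Binary.PropositionalEquality.Core using (_≡_; _≢_)

-- Adjacency is required to be decidable so that degrees can be counted;
-- classically this is no restriction on a finite graph.
record Graph (n : ℕ) : Set₁ where
  field
    Adj    : Rel (Fin n) 0ℓ
    adj?   : Decidable Adj
    sym    : Symmetric Adj
    irrefl : Irreflexive _≡_ Adj

  degree : Fin n → ℕ
  degree v = count (adj? v) (allFin n)

  -- The graph without vertices has maximum degree 0.
  maxDegree : ℕ
  maxDegree = max 0 (toList (map degree (allFin n)))

open Graph public using (maxDegree)

classSize : ∀ {n d} → (Fin n → Fin d) → Fin d → ℕ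
classSize {n} c i = count (λ v → c v ≟ i) (allFin n)

record IsPrescribedColoring {n d : ℕ} (G : Graph n) (ns : Vec ℕ d)
                            (c : Fin n → Fin d) : Set where
  field
    proper : ∀ {u v} → Graph.Adj G u v → c u ≢ c v
    sizes  : ∀ i → classSize c i ≡ lookup ns i

module Submission where

-- A colouring is repaired along the lines of Kierstead and Kostochka's proof of
-- the Hajnal–Szemerédi theorem.  Let s = ⌊n/(r+1)⌋ and suppose that a proper
-- colouring has the right class sizes, except that class p has one vertex too
-- many and class m one too few.  If p is accessible, i.e. some chain of classes
-- each having a vertex that can be moved to the next leads from p to m, then
-- shifting along the chain repairs the colouring.  Otherwise let a be the number
-- of accessible classes, B the set of vertices in the other classes and
-- q = r + 1 − a.  Every vertex of B has a neighbour in each accessible class, so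
-- it has fewer than q neighbours in B, while |B| > q s as all classes have at
-- most s vertices; in particular the theorem for q − 1 < r applies to B with any
-- one vertex removed.  Take accessible classes T all of whose chains to m pass
-- through one class U, with T minimal; every class of T is then dispensable for
-- the accessibility of the others.  Call z in T and y in B solo neighbours if z
-- is the only neighbour of y in the class of z.  Double counting yields either a
-- solo z movable to another accessible class, or a z with two nonadjacent solo
-- neighbours in B.  Moving one solo neighbour y into the class of z, recolouring
-- the rest of B by induction and moving z away either repairs the colouring or
-- makes more classes accessible.

open import Defs
open import Data.Fin.Base using (Fin; zero; suc)
open import Data.Nat.Base using (ℕ; zero; suc; _+_; _*_; _∸_; _≤_; _<_; z≤n; s≤s; >-nonZero)
open import Data.Nat.DivMod using (_/_; m/n*n≤m)
open import Data.Product.Base using (Σ; ∃; _×_; _,_; proj₁; proj₂)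
open import Data.Vec.Base using (Vec; []; _∷_; allFin; count; lookup; sum; tabulate)
open import Relation.Binary.PropositionalEquality.Core
  using (_≡_; _≢_; refl; sym; trans; cong; cong₂; subst; subst₂)
open import Data.Bool.Base using (Bool; true; false; _∧_; _∨_; not; if_then_else_)
open import Data.Bool.Properties using (¬-not; ∧-comm; ∧-zeroʳ) renaming (_≟_ to _≟ᵇ_)
open import Data.Empty using (⊥; ⊥-elim)
open import Data.Fin.Properties using (_≟_; any?; suc-injective)
import Data.List.Base as List
open import Data.List.Base using (List; []; _∷_; length)
open import Data.List.Extrema.Nat using (xs≤max)
open import Data.List.Membership.DecPropositional using () renaming (_∈?_ to member?)
open import Data.List.Membership.Propositional using (_∈_; _∉_)
open import Data.List.Membership.Propositional.Properties using (∈-allFin)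
import Data.List.Relation.Unary.All as All
open import Data.List.Relation.Unary.Any using (here; there)
open import Data.Nat.Induction using (<-rec)
open import Data.Nat.Properties hiding (_≟_; suc-injective)
open import Data.Nat.Properties using () renaming (_≟_ to _≟ⁿ_)
open import Data.Nat.Tactic.RingSolver using (solve-∀)
open import Data.Sum.Base using (_⊎_; inj₁; inj₂)
open import Data.Vec.Functional using (updateAt)
open import Data.Vec.Functional.Properties using (updateAt-updates; updateAt-minimal)
open import Data.Vec.Membership.Propositional.Properties using (∈-toList⁺; ∈-map⁺; ∈-allFin⁺)
open import Function.Base using (_∘_; const; id)
open import Relation.Nullary.Decidable.Core using (Dec; yes; no; does; _×-dec_; ¬?; map′)
open import Relation.Nullary.Decidable using (dec-true; dec-false; does-≡)
open import Relation.Nullary.Negation.Core using (¬_; contradiction)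
import Algebra.Properties.CommutativeSemigroup as CommutativeSemigroupProperties
import Algebra.Properties.Semiring.Sum +-*-semiring as Sum

open CommutativeSemigroupProperties *-commutativeSemigroup using (x∙yz≈y∙xz; x∙yz≈xz∙y)
open CommutativeSemigroupProperties +-commutativeSemigroup using (xy∙z≈xz∙y)

private variable
  n d : ℕ

-- Decidable propositions as Booleans

does⇒ : {A : Set} (a? : Dec A) → does a? ≡ true → A
does⇒ (yes a) _ = a

¬does⇒ : {A : Set} (a? : Dec A) → does a? ≡ false → ¬ A
¬does⇒ (no ¬a) _ = ¬a

true≢false : ∀ {b} → b ≡ true → b ≢ false
true≢false refl ()

∧-true : ∀ {a b} → a ∧ b ≡ true → a ≡ true × b ≡ true
∧-true {true} {true} _ = refl , refl

∧-intro : ∀ {a b} → a ≡ true → b ≡ true → a ∧ b ≡ true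
∧-intro refl refl = refl

not-true : ∀ {a} → not a ≡ true → a ≡ false
not-true {false} _ = refl

all-or : {A : Fin n → Set} {B : Set} → (∀ i → A i ⊎ B) → (∀ i → A i) ⊎ B
all-or {n = zero}  f = inj₁ λ ()
all-or {n = suc n} f with f zero | all-or (f ∘ suc)
... | inj₂ b | _      = inj₂ b
... | inj₁ _ | inj₂ b = inj₂ b
... | inj₁ a | inj₁ g = inj₁ λ { zero → a ; (suc i) → g i }

infix 7 _==_

_==_ : Fin n → Fin n → Bool
i == j = does (i ≟ j)

==-refl : (i : Fin n) → (i == i) ≡ true
==-refl i = dec-true (i ≟ i) refl

-- Sums and counts over Fin n

χ : Bool → ℕ
χ true  = 1
χ false = 0

χ-∧ : ∀ a b → χ (a ∧ b) ≡ χ a * χ b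
χ-∧ true  b = sym (*-identityˡ _)
χ-∧ false b = refl

-- Opaque, so that unification can compare sums argument by argument.
opaque
  ∑ : (Fin n → ℕ) → ℕ
  ∑ = Sum.sum

opaque
  unfolding ∑

  ∑-suc : (f : Fin (suc n) → ℕ) → ∑ f ≡ f zero + ∑ (f ∘ suc)
  ∑-suc f = refl

  ∑-cong : {f g : Fin n → ℕ} → (∀ i → f i ≡ g i) → ∑ f ≡ ∑ g
  ∑-cong = Sum.sum-cong-≗

  ∑-+ : (f g : Fin n → ℕ) → ∑ (λ i → f i + g i) ≡ ∑ f + ∑ g
  ∑-+ = Sum.∑-distrib-+

  ∑-swap : (f : Fin n → Fin d → ℕ) → ∑ (λ i → ∑ (f i)) ≡ ∑ λ j → ∑ λ i → f i j
  ∑-swap = Sum.∑-comm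

  *-∑ : ∀ k (f : Fin n → ℕ) → k * ∑ f ≡ ∑ λ i → k * f i
  *-∑ = Sum.*-distribˡ-sum

  ∑-mono : {f g : Fin n → ℕ} → (∀ i → f i ≤ g i) → ∑ f ≤ ∑ g
  ∑-mono {n = zero}  f≤g = z≤n
  ∑-mono {n = suc n} f≤g = +-mono-≤ (f≤g zero) (∑-mono (f≤g ∘ suc))

  ∑-mono-< : {f g : Fin n → ℕ} → (∀ i → f i ≤ g i) → ∀ i → f i < g i → ∑ f < ∑ g
  ∑-mono-< f≤g zero    lt = +-mono-<-≤ lt (∑-mono (f≤g ∘ suc))
  ∑-mono-< f≤g (suc i) lt = +-mono-≤-< (f≤g zero) (∑-mono-< (f≤g ∘ suc) i lt)

  ∑-term : (f : Fin n → ℕ) → ∀ i → f i ≤ ∑ f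
  ∑-term f zero    = m≤m+n _ _
  ∑-term f (suc i) = m≤n⇒m≤o+n (f zero) (∑-term (f ∘ suc) i)

  ∑-zero : {f : Fin n → ℕ} → (∀ i → f i ≡ 0) → ∑ f ≡ 0
  ∑-zero {n = zero}  f≡0 = refl
  ∑-zero {n = suc n} f≡0 = cong₂ _+_ (f≡0 zero) (∑-zero (f≡0 ∘ suc))

  ∑-kronecker : (j : Fin n) (f : Fin n → ℕ) → ∑ (λ i → χ (j == i) * f i) ≡ f j
  ∑-kronecker zero f = trans (cong₂ _+_ (*-identityˡ _) (∑-zero {f = λ i → χ (zero == suc i) * f (suc i)} λ _ → refl)) (+-identityʳ _)
  ∑-kronecker (suc j) f = ∑-kronecker j (f ∘ suc)

# : (Fin n → Bool) → ℕ
# P = ∑ λ i → χ (P i)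

∑-<⇒∃ : (f g : Fin n → ℕ) → ∑ f < ∑ g → ∃ λ i → f i < g i
∑-<⇒∃ f g lt with any? (λ i → f i <? g i)
... | yes p = p
... | no ¬p = contradiction (∑-mono (λ i → ≮⇒≥ (λ q → ¬p (i , q)))) (<⇒≱ lt)

0<∑⇒∃ : (f : Fin n → ℕ) → 0 < ∑ f → ∃ λ i → 0 < f i
0<∑⇒∃ f lt = ∑-<⇒∃ (const 0) f (subst (_< ∑ f) (sym (∑-zero λ _ → refl)) lt)

∑-χ≡ : (j : Fin n) → ∑ (λ i → χ (j == i)) ≡ 1
∑-χ≡ j = trans (∑-cong λ i → sym (*-identityʳ _)) (∑-kronecker j (const 1))

∑-fibre : (c : Fin n → Fin d) (g : Fin d → ℕ) (h : Fin n → ℕ) →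
  ∑ (λ v → g (c v) * h v) ≡ ∑ λ i → g i * ∑ λ v → χ (c v == i) * h v
∑-fibre c g h = begin-equality
  ∑ (λ v → g (c v) * h v)
    ≡⟨ ∑-cong (λ v → sym (∑-kronecker (c v) λ i → g i * h v)) ⟩
  ∑ (λ v → ∑ λ i → χ (c v == i) * (g i * h v))
    ≡⟨ ∑-swap (λ v i → χ (c v == i) * (g i * h v)) ⟩
  ∑ (λ i → ∑ λ v → χ (c v == i) * (g i * h v))
    ≡⟨ ∑-cong (λ i → trans (∑-cong λ v → x∙yz≈y∙xz (χ (c v == i)) (g i) (h v))
         (sym (*-∑ (g i) λ v → χ (c v == i) * h v))) ⟩
  ∑ (λ i → g i * ∑ λ v → χ (c v == i) * h v) ∎
  where
  open ≤-Reasoning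

size : (Fin n → Fin d) → Fin d → ℕ
size c i = # λ v → c v == i

#-fibre : (c : Fin n → Fin d) (P : Fin d → Bool) → # (P ∘ c) ≡ ∑ λ i → χ (P i) * size c i
#-fibre c P = begin-equality
  # (P ∘ c)                                            ≡⟨ ∑-cong (λ v → sym (*-identityʳ _)) ⟩
  ∑ (λ v → χ (P (c v)) * 1)                            ≡⟨ ∑-fibre c (χ ∘ P) (const 1) ⟩
  ∑ (λ i → χ (P i) * ∑ (λ v → χ (c v == i) * 1))
    ≡⟨ ∑-cong (λ i → cong (χ (P i) *_) (∑-cong λ v → *-identityʳ _)) ⟩
  ∑ (λ i → χ (P i) * size c i)                         ∎
  where open ≤-Reasoning

∑-two : (f : Fin n → ℕ) → ∀ {i j} → i ≢ j → f i + f j ≤ ∑ f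
∑-two f {i} {j} i≢j = begin
  f i + f j
    ≡⟨ cong₂ _+_ (sym (∑-kronecker i f)) (sym (∑-kronecker j f)) ⟩
  ∑ (λ k → χ (i == k) * f k) + ∑ (λ k → χ (j == k) * f k)      ≡⟨ sym (∑-+ _ _) ⟩
  ∑ (λ k → χ (i == k) * f k + χ (j == k) * f k)                ≤⟨ ∑-mono term ⟩
  ∑ f                                                          ∎
  where
  open ≤-Reasoning
  term : ∀ k → χ (i == k) * f k + χ (j == k) * f k ≤ f k
  term k with i ≟ k | j ≟ k
  ... | yes refl | yes refl = contradiction refl i≢j
  ... | yes _    | no  _    = ≤-reflexive (trans (+-identityʳ _) (*-identityˡ _))
  ... | no  _    | yes _    = ≤-reflexive (*-identityˡ _)
  ... | no  _    | no  _    = z≤n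

#-cong : {P Q : Fin n → Bool} → (∀ i → P i ≡ Q i) → # P ≡ # Q
#-cong P≡Q = ∑-cong λ i → cong χ (P≡Q i)

χ*-mono : ∀ {b x y} → (b ≡ true → x ≤ y) → χ b * x ≤ χ b * y
χ*-mono {false} _ = z≤n
χ*-mono {true}  h = *-monoʳ-≤ 1 (h refl)

∑χ*-≤ : (P : Fin n → Bool) {f : Fin n → ℕ} (k : ℕ) → (∀ i → P i ≡ true → f i ≤ k) → ∑ (λ i → χ (P i) * f i) ≤ k * # P
∑χ*-≤ P {f} k h = ≤-trans (∑-mono λ i → ≤-trans (χ*-mono {P i} (h i)) (≤-reflexive (*-comm _ k)))
  (≤-reflexive (sym (*-∑ k (χ ∘ P))))

∑χ*-≥ : (P : Fin n → Bool) {f : Fin n → ℕ} (k : ℕ) → (∀ i → P i ≡ true → k ≤ f i) → k * # P ≤ ∑ (λ i → χ (P i) * f i)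
∑χ*-≥ P {f} k h = ≤-trans (≤-reflexive (*-∑ k (χ ∘ P)))
  (∑-mono λ i → ≤-trans (≤-reflexive (*-comm k _)) (χ*-mono {P i} (h i)))

χ-mono : ∀ {a b} → (a ≡ true → b ≡ true) → χ a ≤ χ b
χ-mono {false}         _ = z≤n
χ-mono {true}  h rewrite h refl = ≤-refl

#-mono-< : {P Q : Fin n → Bool} → (∀ i → P i ≡ true → Q i ≡ true) →
  ∀ i → P i ≡ false → Q i ≡ true → # P < # Q
#-mono-< {P = P} {Q} P⊆Q i ¬Pi Qi = ∑-mono-< (λ j → χ-mono (P⊆Q j)) i
  (subst₂ (λ a b → χ a < χ b) (sym ¬Pi) (sym Qi) ≤-refl)

1≤# : {P : Fin n → Bool} → ∀ i → P i ≡ true → 1 ≤ # P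
1≤# {P = P} i Pi = subst (λ b → χ b ≤ # P) Pi (∑-term (χ ∘ P) i)

0<#⇒∃ : (P : Fin n → Bool) → 0 < # P → ∃ λ i → P i ≡ true
0<#⇒∃ P lt with 0<∑⇒∃ (χ ∘ P) lt
... | i , q with P i in eq
...   | true = i , eq

opaque
  unfolding ∑

  #-unique : (P : Fin n → Bool) → (∀ i j → P i ≡ true → P j ≡ true → i ≡ j) → # P ≤ 1
  #-unique {n = zero}  P uniq = z≤n
  #-unique {n = suc n} P uniq with P zero in eq
  ... | false = #-unique (P ∘ suc) λ i j p q → suc-injective (uniq _ _ p q)
  ... | true  = s≤s (≤-reflexive (∑-zero λ i → rest i))
    where
    rest : ∀ i → χ (P (suc i)) ≡ 0
    rest i with P (suc i) in eq′
    ... | false = refl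
    ... | true  with () ← uniq _ _ eq eq′

-- Recolouring a single vertex

_[_↦_] : (Fin n → Fin d) → Fin n → Fin d → Fin n → Fin d
c [ v ↦ j ] = updateAt c v (const j)

↦-same : (c : Fin n → Fin d) (v : Fin n) {j : Fin d} → (c [ v ↦ j ]) v ≡ j
↦-same c v = updateAt-updates v c

↦-other : (c : Fin n → Fin d) {v w : Fin n} {j : Fin d} → w ≢ v → (c [ v ↦ j ]) w ≡ c w
↦-other c = updateAt-minimal _ _ c

opaque
  unfolding ∑

  size-↦ : (c : Fin n → Fin d) (v : Fin n) (j i : Fin d) →
    size (c [ v ↦ j ]) i + χ (c v == i) ≡ size c i + χ (j == i)
  size-↦ c zero    j i = +-comm-middle (χ (j == i)) _ (χ (c zero == i))
    where
    +-comm-middle : ∀ x y z → x + y + z ≡ z + y + x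
    +-comm-middle x y z = trans (+-comm (x + y) z) (trans (cong (z +_) (+-comm x y)) (sym (+-assoc z y x)))
  size-↦ c (suc v) j i = trans (+-assoc (χ (c zero == i)) _ _)
    (trans (cong (χ (c zero == i) +_) (size-↦ (c ∘ suc) v j i)) (sym (+-assoc (χ (c zero == i)) _ _)))

-- Degrees and independent sets

infix 4 _∈?_

_∈?_ : (i : Fin d) (L : List (Fin d)) → Dec (i ∈ L)
_∈?_ = member? _≟_

infix 4 _⊆_

_⊆_ : List (Fin d) → (Fin d → Bool) → Set
L ⊆ P = ∀ i → i ∈ L → P i ≡ true

member : List (Fin d) → Fin d → Bool
member L i = does (i ∈? L)

opaque
  deg : (Fin n → Fin n → Bool) → (Fin n → Bool) → Fin n → ℕ
  deg adj P v = ∑ λ w → χ (P w) * χ (adj v w)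

  deg-∑ : ∀ (adj : Fin n → Fin n → Bool) P v → deg adj P v ≡ ∑ λ w → χ (P w) * χ (adj v w)
  deg-∑ adj P v = refl

module _ {n : ℕ} (adj : Fin n → Fin n → Bool) where

  opaque
    unfolding deg

    1≤deg : ∀ {P v} w → P w ≡ true → adj v w ≡ true → 1 ≤ deg adj P v
    1≤deg {P} {v} w Pw vw = ≤-trans (≤-reflexive (sym (cong₂ (λ a b → χ a * χ b) Pw vw)))
      (∑-term (λ w → χ (P w) * χ (adj v w)) w)

    1≤deg⇒∃ : ∀ {P v} → 1 ≤ deg adj P v → ∃ λ w → P w ≡ true × adj v w ≡ true
    1≤deg⇒∃ {P} {v} lt with 0<∑⇒∃ _ lt
    ... | w , q with P w in eq | adj v w in eq′
    ...   | true | true = w , eq , eq′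

    deg-mono : ∀ {P Q v} → (∀ w → P w ≡ true → Q w ≡ true) → deg adj P v ≤ deg adj Q v
    deg-mono P⊆Q = ∑-mono λ w → *-monoˡ-≤ _ (χ-mono (P⊆Q w))

  -- Both sides add up `f u * g v` over the ordered adjacent pairs; symmetry of `adj` allows either
  -- end to be summed first.
  handshake : (∀ u v → adj u v ≡ adj v u) → (f g : Fin n → ℕ) →
    ∑ (λ u → f u * ∑ λ v → g v * χ (adj u v)) ≡ ∑ λ v → g v * ∑ λ u → f u * χ (adj v u)
  handshake adj-sym f g = begin-equality
    ∑ (λ u → f u * ∑ λ v → g v * χ (adj u v))   ≡⟨ ∑-cong (λ u → *-∑ (f u) _) ⟩
    ∑ (λ u → ∑ λ v → f u * (g v * χ (adj u v))) ≡⟨ ∑-swap _ ⟩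
    ∑ (λ v → ∑ λ u → f u * (g v * χ (adj u v)))
      ≡⟨ ∑-cong (λ v → ∑-cong λ u → trans (x∙yz≈y∙xz (f u) (g v) _)
                                                     (cong (λ b → g v * (f u * χ b)) (adj-sym u v))) ⟩
    ∑ (λ v → ∑ λ u → g v * (f u * χ (adj v u))) ≡⟨ ∑-cong (λ v → sym (*-∑ (g v) _)) ⟩
    ∑ (λ v → g v * ∑ λ u → f u * χ (adj v u))   ∎
    where
    open ≤-Reasoning

  Independent : (Fin n → Bool) → Set
  Independent I = ∀ u v → I u ≡ true → I v ≡ true → adj u v ≡ false

  -- Greedy choice: the next vertex of `B` joins `I` exactly when it has no neighbour in `I` so far.
  -- Domination is phrased as `1 ≤ χ (I v) + deg adj I v` so that it can be summed over `B`.
  maximalIndependent : (∀ u v → adj u v ≡ adj v u) → (∀ v → adj v v ≡ false) →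
    (B : Fin n → Bool) (vs : List (Fin n)) →
    ∃ λ I → (∀ v → I v ≡ true → B v ≡ true) × Independent I ×
      (∀ v → v ∈ vs → B v ≡ true → 1 ≤ χ (I v) + deg adj I v)
  maximalIndependent adj-sym irr B [] = const false , (λ _ ()) , (λ _ _ ()) , λ _ ()
  maximalIndependent adj-sym irr B (x ∷ vs)
    with I , I⊆B , ind , dom ← maximalIndependent adj-sym irr B vs
    with B x in Bx | deg adj I x in eq
  ... | false | _     = I , I⊆B , ind , λ where
    _ (here refl) Bv → contradiction Bx (true≢false Bv)
    v (there p)   Bv → dom v p Bv
  ... | true  | suc k = I , I⊆B , ind , λ where
    _ (here refl) _  → m≤n⇒m≤o+n (χ (I x)) (subst (1 ≤_) (sym eq) (s≤s z≤n))
    v (there p)   Bv → dom v p Bv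
  ... | true  | zero  = I′ , I′⊆B , ind′ , dom′
    where
    I′ : Fin n → Bool
    I′ v = (x == v) ∨ I v

    split : ∀ v → I′ v ≡ true → x ≡ v ⊎ I v ≡ true
    split v p with x ≟ v
    ... | yes x≡v = inj₁ x≡v
    ... | no  _   = inj₂ p

    I⊆I′ : ∀ v → I v ≡ true → I′ v ≡ true
    I⊆I′ v p with x ≟ v
    ... | yes _ = refl
    ... | no  _ = p

    I′⊆B : ∀ v → I′ v ≡ true → B v ≡ true
    I′⊆B v p with split v p
    ... | inj₁ refl = Bx
    ... | inj₂ q    = I⊆B v q

    apart : ∀ v → I v ≡ true → adj x v ≡ false
    apart v p with adj x v in xv
    ... | false = refl
    ... | true  = contradiction (subst (1 ≤_) eq (1≤deg v p xv)) λ ()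

    ind′ : Independent I′
    ind′ u v p q with split u p | split v q
    ... | inj₁ refl | inj₁ refl = irr x
    ... | inj₁ refl | inj₂ q′   = apart v q′
    ... | inj₂ p′   | inj₁ refl = trans (adj-sym u x) (apart u p′)
    ... | inj₂ p′   | inj₂ q′   = ind u v p′ q′

    dom′ : ∀ v → v ∈ x ∷ vs → B v ≡ true → 1 ≤ χ (I′ v) + deg adj I′ v
    dom′ _ (here refl) _ rewrite ==-refl x = s≤s z≤n
    dom′ v (there p) Bv = ≤-trans (dom v p Bv) (+-mono-≤ (χ-mono (I⊆I′ v)) (deg-mono I⊆I′))

-- Accessible classes

module _ {n d : ℕ} (adj : Fin n → Fin n → Bool) where

  opaque
    nb : (Fin n → Fin d) → Fin n → Fin d → ℕ
    nb c v i = deg adj (λ w → c w == i) v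

    nb-∑ : ∀ c v i → nb c v i ≡ ∑ λ w → χ (c w == i) * χ (adj v w)
    nb-∑ c v i = deg-∑ adj _ v

    1≤nb : ∀ {c v i} w → adj v w ≡ true → c w ≡ i → 1 ≤ nb c v i
    1≤nb {c} {i = i} w vw cw = 1≤deg adj w (dec-true (c w ≟ i) cw) vw

    1≤nb⇒∃ : ∀ {c v i} → 1 ≤ nb c v i → ∃ λ w → adj v w ≡ true × c w ≡ i
    1≤nb⇒∃ {c} {v} {i} lt with 1≤deg⇒∃ adj lt
    ... | w , p , q = w , q , does⇒ (c w ≟ i) p

  deg-fibre : ∀ (c : Fin n → Fin d) (P : Fin d → Bool) v →
    deg adj (λ w → P (c w)) v ≡ ∑ λ i → χ (P i) * nb c v i
  deg-fibre c P v = trans (deg-∑ adj _ v) (trans (∑-fibre c (λ i → χ (P i)) (λ w → χ (adj v w)))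
    (∑-cong λ i → cong (χ (P i) *_) (sym (nb-∑ c v i))))

  Free : (Fin n → Fin d) → Fin n → Fin d → Set
  Free c v i = ∀ w → adj v w ≡ true → c w ≢ i

  nb≡0⇒Free : ∀ {c v i} → nb c v i ≡ 0 → Free c v i
  nb≡0⇒Free eq w vw cw = contradiction (subst (1 ≤_) eq (1≤nb w vw cw)) λ ()

  1≤nb⇒¬Free : ∀ {c v i} → 1 ≤ nb c v i → ¬ Free c v i
  1≤nb⇒¬Free lt free with 1≤nb⇒∃ lt
  ... | w , vw , cw = free w vw cw

  -- The list is an order of discovery starting at `m`, latest class first: each further class has a
  -- vertex `y` that can be moved to some class found earlier. One list thus holds a chain to `m`
  -- from each of its classes.
  data Accessible (c : Fin n → Fin d) (m : Fin d) : List (Fin d) → Set where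
    root : Accessible c m (m ∷ [])
    grow : ∀ {L i j} y → c y ≡ i → Free c y j → j ∈ L → i ∉ L →
           Accessible c m L → Accessible c m (i ∷ L)

  root∈ : ∀ {c m L} → Accessible c m L → m ∈ L
  root∈ root                 = here refl
  root∈ (grow _ _ _ _ _ acc) = there (root∈ acc)

  -- Every tail of an order of discovery is again one, so cutting off the classes in front of `i`
  -- leaves a list headed by `i`.
  suffix : ∀ {c m L i} → Accessible c m L → i ∈ L →
    ∃ λ L′ → Accessible c m (i ∷ L′) × (∀ k → k ∈ i ∷ L′ → k ∈ L) × length L′ < length L
  suffix root (here refl) = [] , root , (λ _ p → p) , s≤s z≤n
  suffix acc@(grow _ _ _ _ _ _) (here refl) = _ , acc , (λ _ p → p) , ≤-refl
  suffix (grow _ _ _ _ _ acc) (there i∈L) with suffix acc i∈L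
  ... | L′ , acc′ , sub , lt = L′ , acc′ , (λ k p → there (sub k p)) , m<n⇒m<1+n lt

  -- Accessibility survives if no vertex leaves or enters a class of `L`: the witnesses keep their
  -- classes, and their target classes receive no new neighbours.
  transfer : ∀ {c c′ m L} → Accessible c m L →
    (∀ v → c v ∈ L → c′ v ≡ c v) → (∀ v → c′ v ∈ L → c′ v ≡ c v) → Accessible c′ m L
  transfer root _ _ = root
  transfer (grow y refl free j∈L i∉L acc) f g =
    grow y (f y (here refl)) (λ w yw c′w → free w yw (trans (sym (g w (there (subst (_∈ _) (sym c′w) j∈L)))) c′w)) j∈L i∉L
      (transfer acc (λ v p → f v (there p)) (λ v p → g v (there p)))

  -- The class i itself may gain vertices, since nothing in the chain moves into it.
  transfer-head : ∀ {c c′ m i L} → Accessible c m (i ∷ L) →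
    (∀ v → c v ∈ i ∷ L → c′ v ≡ c v) → (∀ v → c′ v ∈ L → c′ v ≡ c v) → Accessible c′ m (i ∷ L)
  transfer-head root _ _ = root
  transfer-head (grow y refl free j∈L i∉L acc) f g =
    grow y (f y (here refl)) (λ w yw c′w → free w yw (trans (sym (g w (subst (_∈ _) (sym c′w) j∈L))) c′w)) j∈L i∉L
      (transfer acc (λ v p → f v (there p)) g)

  -- `P` limits the classes considered: `C` for accessibility proper, the accessible classes other
  -- than one `W` when testing whether `W` can be dispensed with.
  Closed : (Fin n → Fin d) → (Fin d → Bool) → List (Fin d) → Set
  Closed c P L = ∀ v j → P (c v) ≡ true → c v ∉ L → j ∈ L → 1 ≤ nb c v j

  missing : List (Fin d) → ℕ
  missing L = # λ i → not (member L i)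

  missing-anti : ∀ {L L′ : List (Fin d)} → (∀ i → i ∈ L → i ∈ L′) →
    ∀ j → not (member L′ j) ≡ true → not (member L j) ≡ true
  missing-anti {L} {L′} L⊆L′ j p with j ∈? L
  ... | no  _   = refl
  ... | yes j∈L = trans (sym (cong not (dec-true (j ∈? L′) (L⊆L′ j j∈L)))) p

  missing-≤ : ∀ {L L′} → (∀ i → i ∈ L → i ∈ L′) → missing L′ ≤ missing L
  missing-≤ L⊆L′ = ∑-mono λ j → χ-mono (missing-anti L⊆L′ j)

  missing-< : ∀ {L L′} → (∀ i → i ∈ L → i ∈ L′) → ∀ i → i ∉ L → i ∈ L′ → missing L′ < missing L
  missing-< {L} {L′} L⊆L′ i i∉L i∈L′ = #-mono-< (missing-anti L⊆L′) i
    (cong not (dec-true (i ∈? L′) i∈L′)) (cong not (dec-false (i ∈? L) i∉L))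

  -- As long as a vertex of a class in `P` outside `L` can be moved into `L`, its class is added.
  -- Each addition lowers `missing`, so `k` bounds the number of rounds.
  closure : ∀ k c m P L → missing L < k → Accessible c m L → L ⊆ P →
    ∃ λ L′ → Accessible c m L′ × (∀ i → i ∈ L → i ∈ L′) × L′ ⊆ P × Closed c P L′
  closure (suc k) c m P L (s≤s lt) acc L⊆P
    with any? (λ v → any? λ j → (P (c v) ≟ᵇ true) ×-dec ¬? (c v ∈? L) ×-dec (j ∈? L) ×-dec (nb c v j ≟ⁿ 0))
  ... | no none = L , acc , (λ _ p → p) , L⊆P , closed
    where
    closed : Closed c P L
    closed v j Pv v∉L j∈L with nb c v j in eq
    ... | zero  = contradiction (v , j , Pv , v∉L , j∈L , eq) none
    ... | suc _ = s≤s z≤n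
  ... | yes (v , j , Pv , v∉L , j∈L , eq)
    with L′ , acc′ , sub , L′⊆P , closed ← closure k c m P (c v ∷ L)
           (<-≤-trans (missing-< (λ _ → there) (c v) v∉L (here refl)) lt)
           (grow v refl (nb≡0⇒Free eq) j∈L v∉L acc)
           (λ { _ (here refl) → Pv ; i (there p) → L⊆P i p })
    = L′ , acc′ , (λ i p → sub i (there p)) , L′⊆P , closed

  -- Induction along the order of discovery: the target `j` of the witness `y` lies in `K` already,
  -- so if the class of `y` did not, `Closed` would give `y` a neighbour in `j`.
  absorbs : ∀ {c m P K L} → Closed c P K → m ∈ K → Accessible c m L → L ⊆ P → ∀ i → i ∈ L → i ∈ K
  absorbs closed m∈K root L⊆P _ (here refl) = m∈K
  absorbs closed m∈K (grow _ _ _ _ _ acc) L⊆P i (there p) =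
    absorbs closed m∈K acc (λ k q → L⊆P k (there q)) i p
  absorbs {c} {K = K} closed m∈K (grow {j = j} y refl free j∈L _ acc) L⊆P _ (here refl) with c y ∈? K
  ... | yes p = p
  ... | no ¬p = contradiction free
    (1≤nb⇒¬Free (closed y j (L⊆P _ (here refl)) ¬p (absorbs closed m∈K acc (λ k q → L⊆P k (there q)) j j∈L)))

-- Class sizes and shifting along accessible classes

-- f is g with one unit moved from i to j, stated without subtraction.
record Balance (f g : Fin d → ℕ) (i j : Fin d) : Set where
  constructor balance
  field at : ∀ k → f k + χ (i == k) ≡ g k + χ (j == k)

open Balance

Balance-trans : ∀ {f g h : Fin d → ℕ} {i j k} → Balance f g j k → Balance g h i j → Balance f h i k
Balance-trans {f = f} {g} {h} {i} {j} {k} p q .at l = +-cancelʳ-≡ (χ (j == l)) _ _ (begin-equality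
  f l + χ (i == l) + χ (j == l)   ≡⟨ xy∙z≈xz∙y (f l) _ _ ⟩
  f l + χ (j == l) + χ (i == l)   ≡⟨ cong (_+ χ (i == l)) (p .at l) ⟩
  g l + χ (k == l) + χ (i == l)   ≡⟨ xy∙z≈xz∙y (g l) _ _ ⟩
  g l + χ (i == l) + χ (k == l)   ≡⟨ cong (_+ χ (k == l)) (q .at l) ⟩
  h l + χ (j == l) + χ (k == l)   ≡⟨ xy∙z≈xz∙y (h l) _ _ ⟩
  h l + χ (k == l) + χ (j == l)   ∎)
  where
  open ≤-Reasoning

size-balance : (c : Fin n → Fin d) (v : Fin n) (j : Fin d) → Balance (size (c [ v ↦ j ])) (size c) (c v) j
size-balance c v j = balance (size-↦ c v j)

-- Only the vertices in `X` are recoloured, with the colours in `C`; all else keeps its colour. The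
-- induction can thus pass to a part of the graph without changing `Fin n` or `Fin d`.
module Recolouring {n d : ℕ} (adj : Fin n → Fin n → Bool)
  (adj-sym : ∀ u v → adj u v ≡ adj v u) (adj-irr : ∀ v → adj v v ≡ false)
  (X : Fin n → Bool) (C : Fin d → Bool) (c₀ : Fin n → Fin d) where

  Inside : (Fin n → Fin d) → Set
  Inside c = ∀ v → C (c v) ≡ X v

  Fixed : (Fin n → Fin d) → Set
  Fixed c = ∀ v → X v ≡ false → c v ≡ c₀ v

  record Valid (c : Fin n → Fin d) : Set where
    field
      inside : Inside c
      fixed  : Fixed c
      proper : ∀ u v → X u ≡ true → X v ≡ true → adj u v ≡ true → c u ≢ c v

  -- Class `m` is one vertex short and `p` has one too many. For `m ≡ p` the two deviations cancel,
  -- and this is how `shift` ends.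
  Balanced : Fin d → Fin d → (Fin n → Fin d) → Set
  Balanced m p c = Balance (size c) (size c₀) m p

  Solution : Set
  Solution = ∃ λ c → Valid c × (∀ i → size c i ≡ size c₀ i)

  -- Conflicts at `y` vanish when `y` moves to a free class, so `c` need be proper only away from
  -- `y`. This covers a newly activated vertex as well as a vertex `z` in conflict with a newcomer.
  place : ∀ {c y j} → Inside c → Fixed c →
    (∀ u v → u ≢ y → v ≢ y → X u ≡ true → X v ≡ true → adj u v ≡ true → c u ≢ c v) →
    X y ≡ true → C j ≡ true → Free adj c y j → Valid (c [ y ↦ j ])
  place {c} {y} {j} inside fixed proper Xy Cj free = record
    { inside = inside′ ; fixed = fixed′ ; proper = proper′ }
    where
    inside′ : Inside (c [ y ↦ j ])
    inside′ v with v ≟ y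
    ... | yes refl = trans (cong C (↦-same c y)) (trans Cj (sym Xy))
    ... | no  v≢y  = trans (cong C (↦-other c v≢y)) (inside v)

    fixed′ : Fixed (c [ y ↦ j ])
    fixed′ v ¬Xv = trans (↦-other c λ { refl → true≢false Xy ¬Xv }) (fixed v ¬Xv)

    proper′ : ∀ u v → X u ≡ true → X v ≡ true → adj u v ≡ true → (c [ y ↦ j ]) u ≢ (c [ y ↦ j ]) v
    proper′ u v Xu Xv uv eq with u ≟ y | v ≟ y
    ... | yes refl | yes refl = true≢false uv (adj-irr y)
    ... | yes refl | no  v≢y  = free v uv (trans (sym (↦-other c v≢y)) (trans (sym eq) (↦-same c y)))
    ... | no  u≢y  | yes refl = free u (trans (adj-sym y u) uv) (trans (sym (↦-other c u≢y)) (trans eq (↦-same c y)))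
    ... | no  u≢y  | no  v≢y  = proper u v u≢y v≢y Xu Xv uv
      (trans (sym (↦-other c u≢y)) (trans eq (↦-other c v≢y)))

  head∉ : ∀ {c : Fin n → Fin d} {m i L} → Accessible adj c m (i ∷ L) → i ∉ L
  head∉ root               = λ ()
  head∉ (grow _ _ _ _ i∉L _) = i∉L

  -- Moving the witness `y` from `p` to `j` makes `j` the class with the surplus. The shorter chain
  -- from `j` survives, as it avoids `p` and gains a vertex only at its head. At the root the
  -- surplus meets the deficit.
  shift : ∀ k {c m p L} → length L < k → Valid c → Balanced m p c → (p ∷ L) ⊆ C →
    Accessible adj c m (p ∷ L) → Solution
  shift (suc k) {c} {m} _ valid bal _ root = c , valid , λ i → +-cancelʳ-≡ (χ (m == i)) _ _ (bal .at i)
  shift (suc k) {c} {m} {p} {L} (s≤s lt) valid bal L⊆C (grow {j = j} y refl free j∈L p∉L acc)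
    with L′ , acc′ , sub , lt′ ← suffix adj acc j∈L
    = shift k (<-≤-trans lt′ lt) valid′
        (Balance-trans (size-balance c y j) bal)
        (λ i i∈ → L⊆C i (there (sub i i∈)))
        (transfer-head adj acc′ keep keep′)
    where
    open Valid valid
    j∉L′ = head∉ acc′
    valid′ : Valid (c [ y ↦ j ])
    valid′ = place inside fixed (λ u v _ _ → proper u v)
      (trans (sym (inside y)) (L⊆C _ (here refl))) (L⊆C j (there j∈L)) free

    keep : ∀ v → c v ∈ j ∷ L′ → (c [ y ↦ j ]) v ≡ c v
    keep v cv∈ = ↦-other c λ { refl → p∉L (sub _ cv∈) }

    keep′ : ∀ v → (c [ y ↦ j ]) v ∈ L′ → (c [ y ↦ j ]) v ≡ c v
    keep′ v cv∈ = ↦-other c λ { refl → j∉L′ (subst (_∈ L′) (↦-same c y) cv∈) }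

-- The improper c₀ prescribes the class sizes and the colours outside X.
Recolourable : ℕ → ℕ → ℕ → Set
Recolourable r n d =
  (adj : Fin n → Fin n → Bool) (adj-sym : ∀ u v → adj u v ≡ adj v u) (adj-irr : ∀ v → adj v v ≡ false)
  (X : Fin n → Bool) (C : Fin d → Bool) (c₀ : Fin n → Fin d) (s : ℕ) →
  (∀ v → C (c₀ v) ≡ X v) → (∀ i → C i ≡ true → size c₀ i ≤ s) → 1 ≤ s → suc r * s ≤ # X →
  (∀ v → X v ≡ true → deg adj X v ≤ r) → Recolouring.Solution adj adj-sym adj-irr X C c₀

-- Repairing a nearly balanced colouring

module Step {n d r : ℕ} (IH : ∀ r′ → r′ < r → Recolourable r′ n d)
  (adj : Fin n → Fin n → Bool)
  (adj-sym : ∀ u v → adj u v ≡ adj v u) (adj-irr : ∀ v → adj v v ≡ false)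
  (X : Fin n → Bool) (C : Fin d → Bool) (c₀ : Fin n → Fin d) (s : ℕ)
  (inside₀ : ∀ v → C (c₀ v) ≡ X v) (size≤s : ∀ i → C i ≡ true → size c₀ i ≤ s)
  (1≤s : 1 ≤ s) (big : suc r * s ≤ # X) (degX : ∀ v → X v ≡ true → deg adj X v ≤ r) where

  open Recolouring adj adj-sym adj-irr X C c₀
  open ≤-Reasoning

  r<#C : r < # C
  r<#C = *-cancelʳ-≤ (suc r) (# C) s {{>-nonZero 1≤s}} (begin
    suc r * s                        ≤⟨ big ⟩
    # X                              ≡⟨ #-cong (λ v → sym (inside₀ v)) ⟩
    # (λ v → C (c₀ v))               ≡⟨ #-fibre c₀ C ⟩
    ∑ (λ i → χ (C i) * size c₀ i)    ≤⟨ ∑χ*-≤ C s size≤s ⟩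
    s * # C                          ≡⟨ *-comm s _ ⟩
    # C * s                          ∎)

  ∑nb≤r : ∀ {c} → Inside c → ∀ v → X v ≡ true → ∑ (λ j → χ (C j) * nb adj c v j) ≤ r
  ∑nb≤r {c} inside v Xv = begin
    ∑ (λ j → χ (C j) * nb adj c v j)  ≡⟨ sym (deg-fibre adj c C v) ⟩
    deg adj (λ w → C (c w)) v         ≤⟨ deg-mono adj (λ w Cw → trans (sym (inside w)) Cw) ⟩
    deg adj X v                       ≤⟨ degX v Xv ⟩
    r                                 ∎

  -- A vertex of `X` has at most `r` neighbours in `X`, which cannot meet all of the more than `r`
  -- classes.
  freeColour : ∀ {c} → Inside c → ∀ v → X v ≡ true → ∃ λ j → C j ≡ true × Free adj c v j
  freeColour {c} inside v Xv with ∑-<⇒∃ _ _ (≤-<-trans (∑nb≤r inside v Xv) r<#C)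
  ... | j , lt with C j in Cj
  ...   | true = j , Cj , nb≡0⇒Free adj (n<1⇒n≡0 (subst (_< 1) (+-identityʳ _) lt))

  -- An inaccessible class with a surplus

  module Stuck {c : Fin n → Fin d} {m p : Fin d} {L : List (Fin d)}
    (valid : Valid c) (bal : Balanced m p c) (acc : Accessible adj c m L) (L⊆C : L ⊆ C)
    (closed : Closed adj c C L) (Cp : C p ≡ true) (p∉L : p ∉ L) where

    open Valid valid

    R Bᶜ : Fin d → Bool
    R = member L
    Bᶜ i = C i ∧ not (R i)

    A B : Fin n → Bool
    A v = R (c v)
    B v = Bᶜ (c v)

    R⇒∈ : ∀ {i} → R i ≡ true → i ∈ L
    R⇒∈ {i} = does⇒ (i ∈? L)

    ∈⇒R : ∀ {i} → i ∈ L → R i ≡ true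
    ∈⇒R {i} = dec-true (i ∈? L)

    R⇒C : ∀ {i} → R i ≡ true → C i ≡ true
    R⇒C Ri = L⊆C _ (R⇒∈ Ri)

    Bᶜ⇒C : ∀ {i} → Bᶜ i ≡ true → C i ≡ true
    Bᶜ⇒C Bi = proj₁ (∧-true Bi)

    Bᶜ⇒¬R : ∀ {i} → Bᶜ i ≡ true → R i ≡ false
    Bᶜ⇒¬R Bi = not-true (proj₂ (∧-true Bi))

    C-split : ∀ {i} → C i ≡ true → R i ≡ true ⊎ Bᶜ i ≡ true
    C-split {i} Ci with R i in Ri
    ... | true  = inj₁ refl
    ... | false = inj₂ (∧-intro Ci refl)

    B⇒X : ∀ {v} → B v ≡ true → X v ≡ true
    B⇒X {v} Bv = trans (sym (inside v)) (Bᶜ⇒C Bv)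

    A⇒X : ∀ {v} → A v ≡ true → X v ≡ true
    A⇒X {v} Av = trans (sym (inside v)) (R⇒C Av)

    A⇒¬B : ∀ {v} → A v ≡ true → B v ≡ false
    A⇒¬B {v} Av with B v in Bv
    ... | true  = contradiction (Bᶜ⇒¬R Bv) (true≢false Av)
    ... | false = refl

    nb≥1 : ∀ {y j} → B y ≡ true → R j ≡ true → 1 ≤ nb adj c y j
    nb≥1 {y} {j} By Rj = closed y j (Bᶜ⇒C By) (¬does⇒ (c y ∈? L) (Bᶜ⇒¬R By)) (R⇒∈ Rj)

    m∈L : m ∈ L
    m∈L = root∈ adj acc

    m≢p : m ≢ p
    m≢p refl = p∉L m∈L

    a : ℕ
    a = # R

    1≤a : 1 ≤ a
    1≤a = 1≤# m (∈⇒R m∈L)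

    Bᶜp : Bᶜ p ≡ true
    Bᶜp = ∧-intro Cp (cong not (dec-false (p ∈? L) p∉L))

    -- As `m ≢ p`, class `p` has one vertex more than prescribed. Its vertex `v₀` later takes the
    -- place of a vertex that leaves `B`.
    overfull : ∃ λ v → c v ≡ p
    overfull with v , eq ← 0<#⇒∃ (λ v → c v == p) (m+n≤o⇒n≤o (size c₀ p) (≤-reflexive (begin-equality
        size c₀ p + 1                ≡⟨ cong (λ b → size c₀ p + χ b) (sym (==-refl p)) ⟩
        size c₀ p + χ (p == p)       ≡⟨ sym (bal .at p) ⟩
        size c p + χ (m == p)        ≡⟨ cong (λ b → size c p + χ b) (dec-false (m ≟ p) m≢p) ⟩
        size c p + 0                 ≡⟨ +-identityʳ _ ⟩
        size c p                     ∎)))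
      = v , does⇒ (c v ≟ p) eq

    v₀ : Fin n
    v₀ = proj₁ overfull

    cv₀ : c v₀ ≡ p
    cv₀ = proj₂ overfull

    Bv₀ : B v₀ ≡ true
    Bv₀ = trans (cong Bᶜ cv₀) Bᶜp

    -- Each class of `P` uses up at least one of the at most `r` neighbours of `v` in `X`; the
    -- neighbours in `B` lie in other classes.
    deg-bound : (P : Fin d → Bool) → (∀ j → P j ≡ true → R j ≡ true) → ∀ v → X v ≡ true →
      (∀ j → P j ≡ true → 1 ≤ nb adj c v j) → # P + deg adj B v ≤ r
    deg-bound P P⊆R v Xv pos = begin
      # P + deg adj B v                                   ≡⟨ cong (# P +_) (deg-fibre adj c Bᶜ v) ⟩
      # P + ∑ (λ j → χ (Bᶜ j) * nb adj c v j)             ≡⟨ sym (∑-+ _ _) ⟩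
      ∑ (λ j → χ (P j) + χ (Bᶜ j) * nb adj c v j)         ≤⟨ ∑-mono term ⟩
      ∑ (λ j → χ (C j) * nb adj c v j)                    ≤⟨ ∑nb≤r inside v Xv ⟩
      r                                                   ∎
      where
      term : ∀ j → χ (P j) + χ (Bᶜ j) * nb adj c v j ≤ χ (C j) * nb adj c v j
      term j with P j in Pj
      ... | true rewrite R⇒C (P⊆R j Pj) | P⊆R j Pj =
        subst (1 ≤_) (sym (*-identityˡ _)) (pos j Pj)
      ... | false with C j | R j
      ...   | false | _     = z≤n
      ...   | true  | false = ≤-refl
      ...   | true  | true  = z≤n

    degB : ∀ y → B y ≡ true → a + deg adj B y ≤ r
    degB y By = deg-bound R (λ _ p → p) y (B⇒X By) (λ _ → nb≥1 By)

    q′ : ℕ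
    q′ = r ∸ a

    -- The subtraction in `q′` is exact: `v₀` in `B` has a neighbour in each of the `a` accessible
    -- classes, whence `a ≤ r`.
    a+q′≡r : a + q′ ≡ r
    a+q′≡r = m+[n∸m]≡n (m+n≤o⇒m≤o a (degB v₀ Bv₀))

    q : ℕ
    q = suc q′

    degB≤q′ : ∀ y → B y ≡ true → deg adj B y ≤ q′
    degB≤q′ y By = +-cancelˡ-≤ a _ _ (≤-trans (degB y By) (≤-reflexive (sym a+q′≡r)))

    q′<r : q′ < r
    q′<r = subst (q′ <_) a+q′≡r (+-monoˡ-≤ q′ 1≤a)

    size-R : ∀ i → R i ≡ true → size c i + χ (m == i) ≤ s
    size-R i Ri = begin
      size c i + χ (m == i)     ≡⟨ bal .at i ⟩
      size c₀ i + χ (p == i)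
        ≡⟨ cong (λ b → size c₀ i + χ b) (dec-false (p ≟ i) λ { refl → p∉L (R⇒∈ Ri) }) ⟩
      size c₀ i + 0             ≡⟨ +-identityʳ _ ⟩
      size c₀ i                 ≤⟨ size≤s i (R⇒C Ri) ⟩
      s                         ∎

    size-R≤s : ∀ i → R i ≡ true → size c i ≤ s
    size-R≤s i Ri = m+n≤o⇒m≤o _ (size-R i Ri)

    #A<as : # A < s * a
    #A<as = begin-strict
      # A                                                   ≡⟨ #-fibre c R ⟩
      ∑ (λ i → χ (R i) * size c i)
        <⟨ ∑-mono-< (λ i → χ*-mono {R i} λ _ → m≤m+n _ _) m atRoot ⟩
      ∑ (λ i → χ (R i) * (size c i + χ (m == i)))           ≤⟨ ∑χ*-≤ R s size-R ⟩
      s * a                                                 ∎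
      where
      atRoot : χ (R m) * size c m < χ (R m) * (size c m + χ (m == m))
      atRoot rewrite ∈⇒R m∈L | ==-refl m | +-identityʳ (size c m) | +-identityʳ (size c m + 1)
        = ≤-reflexive (+-comm 1 (size c m))

    -- Of the at least `(r+1)s = (a+q)s` vertices in `X`, fewer than `a s` are in `A`, since class
    -- `m` is one vertex short.
    qs<#B : q * s < # B
    qs<#B = +-cancelˡ-< (# A) _ _ (begin-strict
      # A + q * s         <⟨ +-monoˡ-< (q * s) #A<as ⟩
      s * a + q * s       ≡⟨ cong (_+ q * s) (*-comm s a) ⟩
      a * s + q * s       ≡⟨ sym (*-distribʳ-+ s a q) ⟩
      (a + q) * s         ≡⟨ cong (_* s) (trans (+-suc a q′) (cong suc a+q′≡r)) ⟩
      suc r * s           ≤⟨ big ⟩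
      # X                 ≤⟨ ∑-mono split ⟩
      ∑ (λ v → χ (A v) + χ (B v)) ≡⟨ ∑-+ _ _ ⟩
      # A + # B           ∎)
      where
      split : ∀ v → χ (X v) ≤ χ (A v) + χ (B v)
      split v rewrite sym (inside v) with C (c v) | R (c v)
      ... | false | _     = z≤n
      ... | true  | true  = ≤-refl
      ... | true  | false = ≤-refl

    -- Weighted edges between `B` and `W` are counted from both ends: each vertex of `B` receives at
    -- least `k`, and each of the at most `s` vertices of `W` gives at most `k q`. This contradicts
    -- `qs<#B`.
    crossCount : ∀ k W (w : Fin n → ℕ) → 1 ≤ k → R W ≡ true →
      (∀ y → B y ≡ true → k ≤ ∑ λ z → (χ (c z == W) * w z) * χ (adj y z)) →
      (∀ z → c z ≡ W → w z * deg adj B z ≤ k * q) → ⊥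
    crossCount k W w 1≤k RW lower upper = <-irrefl refl (begin-strict
      k * (q * s)
        <⟨ *-monoʳ-< k {{>-nonZero 1≤k}} qs<#B ⟩
      k * # B                                                           ≤⟨ ∑χ*-≥ B k lower ⟩
      ∑ (λ y → χ (B y) * ∑ λ z → (χ (c z == W) * w z) * χ (adj y z))
        ≡⟨ handshake adj adj-sym (λ y → χ (B y)) (λ z → χ (c z == W) * w z) ⟩
      ∑ (λ z → (χ (c z == W) * w z) * ∑ λ y → χ (B y) * χ (adj z y))
        ≡⟨ ∑-cong (λ z → trans (cong ((χ (c z == W) * w z) *_) (sym (deg-∑ adj B z))) (*-assoc (χ (c z == W)) _ _)) ⟩
      ∑ (λ z → χ (c z == W) * (w z * deg adj B z))
        ≤⟨ ∑χ*-≤ _ (k * q) (λ z eq → upper z (does⇒ (c z ≟ W) eq)) ⟩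
      k * q * size c W
        ≤⟨ *-monoʳ-≤ (k * q) (size-R≤s W RW) ⟩
      k * q * s                                                         ≡⟨ *-assoc k q s ⟩
      k * (q * s)                                                       ∎)

    -- Terminal classes

    Terminal : Fin d → Set
    Terminal W = ∃ λ L′ → Accessible adj c m L′ × (∀ i → i ∈ L′ → i ∈ L × i ≢ W) ×
      (∀ i → i ∈ L → i ≢ W → i ∈ L′)

    -- The accessible classes outside K ∪ {U} cannot reach m without passing through U.
    record Blocking : Set where
      field
        U       : Fin d
        K       : List (Fin d)
        U∈L     : U ∈ L
        K⊆R     : K ⊆ R
        chain   : Accessible adj c m (U ∷ K)

      T : Fin d → Bool
      T j = R j ∧ not (member (U ∷ K) j)

      field
        blocked : ∀ v j → T (c v) ≡ true → j ∈ K → 1 ≤ nb adj c v j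
        some    : ∃ λ W → T W ≡ true

      T⇒R : ∀ {j} → T j ≡ true → R j ≡ true
      T⇒R Tj = proj₁ (∧-true Tj)

      T⇒∉ : ∀ {j} → T j ≡ true → j ∉ U ∷ K
      T⇒∉ {j} Tj = ¬does⇒ (j ∈? U ∷ K) (not-true (proj₂ (∧-true {R j} Tj)))

      T-intro : ∀ {j} → R j ≡ true → j ∉ U ∷ K → T j ≡ true
      T-intro {j} Rj j∉ = ∧-intro Rj (cong not (dec-false (j ∈? U ∷ K) j∉))

    module Refine (b : Blocking) (W : Fin d) where
      open Blocking b

      P : Fin d → Bool
      P j = R j ∧ not (W == j)

      P-intro : ∀ {j} → R j ≡ true → j ≢ W → P j ≡ true
      P-intro {j} Rj j≢W = ∧-intro Rj (cong not (dec-false (W ≟ j) λ { refl → j≢W refl }))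

      P⇒R : ∀ {j} → P j ≡ true → R j ≡ true
      P⇒R {j} Pj = proj₁ (∧-true {R j} Pj)

      P⇒≢ : ∀ {j} → P j ≡ true → j ≢ W
      P⇒≢ {j} Pj refl = ¬does⇒ (W ≟ W) (not-true (proj₂ (∧-true {R W} Pj))) refl

      -- Close `U ∷ K` among the accessible classes other than `W`. If all of them are reached, `W`
      -- is terminal. Otherwise those left over reach `m` only through `W`, so `W` takes the part of
      -- `U`; the new `T` lies in the old one and has lost `W`.
      refine : T W ≡ true → Terminal W ⊎ ∃ λ b′ → # (Blocking.T b′) < # T
      refine TW
        with K′ , acc′ , sub , K′⊆P , closed′ ← closure adj (suc (missing adj (U ∷ K))) c m P (U ∷ K) ≤-refl chain
               (λ { _ (here refl) → P-intro (∈⇒R U∈L) (λ { refl → T⇒∉ TW (here refl) })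
                  ; k (there k∈K) → P-intro (K⊆R k k∈K) (λ { refl → T⇒∉ TW (there k∈K) }) })
        with any? (λ j → (P j ≟ᵇ true) ×-dec ¬? (j ∈? K′))
      ... | no none = inj₁ (K′ , acc′ , (λ i i∈ → R⇒∈ (P⇒R (K′⊆P i i∈)) , P⇒≢ (K′⊆P i i∈)) , full)
        where
        full : ∀ i → i ∈ L → i ≢ W → i ∈ K′
        full i i∈L i≢W with i ∈? K′
        ... | yes p = p
        ... | no ¬p = contradiction (i , P-intro (∈⇒R i∈L) i≢W , ¬p) none
      ... | yes (j , Pj , j∉K′) = inj₂ (b′ , #-mono-< T′⊆T W T′W TW)
        where
        W∉K′ : W ∉ K′
        W∉K′ W∈ = P⇒≢ (K′⊆P W W∈) refl

        -- The witness for `W` moves into a class whose own chain to `m` avoids `W`, and `absorbs`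
        -- puts that class into `K′`.
        chain′ : Accessible adj c m (W ∷ K′)
        chain′ with suffix adj acc (R⇒∈ (T⇒R TW))
        ... | _ , root , _ = contradiction (root∈ adj chain) (T⇒∉ TW)
        ... | L₀ , grow y cy free i∈L₀ W∉L₀ acc₀ , sub₀ , _ =
          grow y cy free (absorbs adj closed′ (root∈ adj acc′) acc₀
              (λ k k∈ → P-intro (∈⇒R (sub₀ k (there k∈))) λ { refl → W∉L₀ k∈ }) _ i∈L₀)
            W∉K′ acc′

        b′ : Blocking
        b′ = record
          { U = W ; K = K′ ; U∈L = R⇒∈ (T⇒R TW) 
          ; K⊆R = λ k k∈ → P⇒R (K′⊆P k k∈) ; chain = chain′
          ; blocked = λ v i Tv i∈ → closed′ v i
              (P-intro (proj₁ (∧-true {R (c v)} Tv)) λ { refl → ¬does⇒ (c v ∈? (c v ∷ K′)) (not-true (proj₂ (∧-true {R (c v)} Tv))) (here refl) })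
              (λ v∈ → ¬does⇒ (c v ∈? (W ∷ K′)) (not-true (proj₂ (∧-true {R (c v)} Tv))) (there v∈)) i∈
          ; some = j , ∧-intro (P⇒R Pj) (cong not (dec-false (j ∈? (W ∷ K′))
              λ { (here refl) → P⇒≢ Pj refl ; (there j∈) → j∉K′ j∈ })) }

        T′⊆T : ∀ i → Blocking.T b′ i ≡ true → T i ≡ true
        T′⊆T i T′i = T-intro (Blocking.T⇒R b′ T′i) λ i∈ → Blocking.T⇒∉ b′ T′i (there (sub i i∈))

        T′W : Blocking.T b′ W ≡ false
        T′W = trans (cong (λ x → R W ∧ not x) (dec-true (W ∈? (W ∷ K′)) (here refl))) (∧-zeroʳ (R W))

    minimal : ∀ k (b : Blocking) → # (Blocking.T b) < k →
      Σ Blocking λ b → ∀ W → Blocking.T b W ≡ true → Terminal W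
    minimal (suc k) b (s≤s lt) with all-or step
      where
      step : ∀ W → (Blocking.T b W ≡ true → Terminal W) ⊎ ∃ λ b′ → # (Blocking.T b′) < # (Blocking.T b)
      step W with Blocking.T b W in TW
      ... | false = inj₁ λ ()
      ... | true with Refine.refine b W TW
      ...   | inj₁ t = inj₁ (const t)
      ...   | inj₂ x = inj₂ x
    ... | inj₁ terminal  = b , terminal
    ... | inj₂ (b′ , lt′) = minimal k b′ (<-≤-trans lt′ lt)

    -- Any accessible class besides `m` allows the start with `U = m` and `K` empty. If there is
    -- none, then `a ≤ 1` and `r ≤ q`, so the vertices of `m` send at most `q s` edges to `B`, too
    -- few for each vertex of `B` to have a neighbour in `m`.
    blocking : Blocking
    blocking with any? (λ j → (R j ≟ᵇ true) ×-dec ¬? (j ∈? (m ∷ [])))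
    ... | yes (W , RW , W∉) = record
      { U = m ; K = [] ; U∈L = m∈L ; K⊆R = λ _ () ; chain = root
      ; blocked = λ _ _ _ ()
      ; some = W , ∧-intro RW (cong not (dec-false (W ∈? (m ∷ [])) W∉)) }
    ... | no none = ⊥-elim (crossCount 1 m (const 1) ≤-refl (∈⇒R m∈L) lower upper)
      where
      a≤1 : a ≤ 1
      a≤1 = #-unique R λ i j Ri Rj → trans (only i Ri) (sym (only j Rj))
        where
        only : ∀ i → R i ≡ true → i ≡ m
        only i Ri with i ∈? (m ∷ []) in eq
        ... | yes (here i≡m) = i≡m
        ... | no i∉          = contradiction (i , Ri , i∉) none

      lower : ∀ y → B y ≡ true → 1 ≤ ∑ λ z → (χ (c z == m) * 1) * χ (adj y z)
      lower y By = ≤-trans (nb≥1 By (∈⇒R m∈L)) (≤-reflexive (trans (nb-∑ adj c y m)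
        (∑-cong λ z → cong (_* χ (adj y z)) (sym (*-identityʳ (χ (c z == m)))))))

      upper : ∀ z → c z ≡ m → 1 * deg adj B z ≤ 1 * q
      upper z cz = *-monoʳ-≤ 1 (begin
        deg adj B z   ≤⟨ deg-mono adj (λ _ → B⇒X) ⟩
        deg adj X z   ≤⟨ degX z (A⇒X (trans (cong R cz) (∈⇒R m∈L))) ⟩
        r             ≡⟨ sym a+q′≡r ⟩
        a + q′        ≤⟨ +-monoˡ-≤ q′ a≤1 ⟩
        q             ∎)

    -- Solo neighbours and double counting

    solo : Fin n → Fin n → Bool
    solo y z = adj y z ∧ does (nb adj c y (c z) ≟ⁿ 1)

    solo-adj : ∀ {y z} → solo y z ≡ true → adj y z ≡ true
    solo-adj yz = proj₁ (∧-true yz)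

    solo-nb : ∀ {y z} → solo y z ≡ true → nb adj c y (c z) ≡ 1
    solo-nb {y} {z} yz = does⇒ (nb adj c y (c z) ≟ⁿ 1) (proj₂ (∧-true {adj y z} yz))

    solo-intro : ∀ {y z} → adj y z ≡ true → nb adj c y (c z) ≡ 1 → solo y z ≡ true
    solo-intro {y} {z} yz eq = ∧-intro yz (dec-true (nb adj c y (c z) ≟ⁿ 1) eq)

    solo-unique : ∀ {y z w} → solo y z ≡ true → adj y w ≡ true → c w ≡ c z → w ≡ z
    solo-unique {y} {z} {w} yz yw cw with w ≟ z
    ... | yes w≡z = w≡z
    ... | no  w≢z = contradiction (begin
      2
        ≡⟨ sym (cong₂ _+_ (one w cw yw) (one z refl (solo-adj yz))) ⟩
      χ (c w == c z) * χ (adj y w) + χ (c z == c z) * χ (adj y z)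
        ≤⟨ ∑-two (λ x → χ (c x == c z) * χ (adj y x)) w≢z ⟩
      ∑ (λ x → χ (c x == c z) * χ (adj y x))           ≡⟨ sym (nb-∑ adj c y (c z)) ⟩
      nb adj c y (c z)                                 ≡⟨ solo-nb yz ⟩
      1                                                ∎) λ { (s≤s ()) }
      where
      one : ∀ x → c x ≡ c z → adj y x ≡ true → χ (c x == c z) * χ (adj y x) ≡ 1
      one x cx yx = cong₂ (λ b b′ → χ b * χ b′) (dec-true (c x ≟ c z) cx) yx

    module Counting (b : Blocking) where
      open Blocking b

      -- `Escape` and `Pair` are the two configurations that `resolve` can exploit; `crowded` shows
      -- that they cannot both be absent.
      Escape : Set
      Escape = ∃ λ z → ∃ λ y → ∃ λ j →
        T (c z) ≡ true × B y ≡ true × solo y z ≡ true × R j ≡ true × c z ≢ j × nb adj c z j ≡ 0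

      Pair : Set
      Pair = ∃ λ z → ∃ λ y₁ → ∃ λ y₂ →
        T (c z) ≡ true × B y₁ ≡ true × B y₂ ≡ true × solo y₁ z ≡ true × solo y₂ z ≡ true ×
        y₁ ≢ y₂ × adj y₁ y₂ ≡ false

      escape? : Dec Escape
      escape? = any? λ z → any? λ y → any? λ j →
        (T (c z) ≟ᵇ true) ×-dec (B y ≟ᵇ true) ×-dec (solo y z ≟ᵇ true) ×-dec (R j ≟ᵇ true) ×-dec
        ¬? (c z ≟ j) ×-dec (nb adj c z j ≟ⁿ 0)

      pair? : Dec Pair
      pair? = any? λ z → any? λ y₁ → any? λ y₂ →
        (T (c z) ≟ᵇ true) ×-dec (B y₁ ≟ᵇ true) ×-dec (B y₂ ≟ᵇ true) ×-dec (solo y₁ z ≟ᵇ true) ×-dec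
        (solo y₂ z ≟ᵇ true) ×-dec ¬? (y₁ ≟ y₂) ×-dec (adj y₁ y₂ ≟ᵇ false)

      t : ℕ
      t = # T

      T⇒A⇒X : ∀ {z} → T (c z) ≡ true → X z ≡ true
      T⇒A⇒X Tz = A⇒X (T⇒R Tz)

      a≤K+t+1 : a ≤ # (member K) + (t + 1)
      a≤K+t+1 = begin
        ∑ (λ j → χ (R j))                                             ≤⟨ ∑-mono cover ⟩
        ∑ (λ j → χ (member K j) + (χ (T j) + χ (U == j)))             ≡⟨ ∑-+ _ _ ⟩
        # (member K) + ∑ (λ j → χ (T j) + χ (U == j))
          ≡⟨ cong (# (member K) +_) (trans (∑-+ _ _) (cong (t +_) (∑-χ≡ U))) ⟩
        # (member K) + (t + 1)                                        ∎
        where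
        cover : ∀ j → χ (R j) ≤ χ (member K j) + (χ (T j) + χ (U == j))
        cover j = cases (R j ≟ᵇ true) (j ∈? (U ∷ K))
          where
          cases : Dec (R j ≡ true) → Dec (j ∈ U ∷ K) → χ (R j) ≤ χ (member K j) + (χ (T j) + χ (U == j))
          cases (no ¬Rj) _ = ≤-trans (χ-mono {b = false} λ Rj → contradiction Rj ¬Rj) z≤n
          cases (yes Rj) (yes (there j∈K)) = ≤-trans (χ-mono λ _ → dec-true (j ∈? K) j∈K) (m≤m+n _ _)
          cases (yes Rj) (yes (here refl)) = ≤-trans (χ-mono λ _ → ==-refl j) (m≤n⇒m≤o+n (χ (member K j)) (m≤n+m _ (χ (T j))))
          cases (yes Rj) (no j∉) = ≤-trans (χ-mono λ _ → T-intro Rj j∉) (m≤n⇒m≤o+n (χ (member K j)) (m≤m+n _ _))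

      -- By `blocked`, `z` has a neighbour in each class of `K`, and `K` covers all accessible
      -- classes except `U` and the `t` classes of `T`.
      degB-T : ∀ z → T (c z) ≡ true → deg adj B z ≤ q + t
      degB-T z Tz = +-cancelˡ-≤ (# (member K)) _ _ (begin
        # (member K) + deg adj B z
          ≤⟨ deg-bound (member K) (λ j j∈ → K⊆R j (does⇒ (j ∈? K) j∈)) z (T⇒A⇒X Tz) (λ j j∈ → blocked z j Tz (does⇒ (j ∈? K) j∈)) ⟩
        r                             ≡⟨ sym a+q′≡r ⟩
        a + q′                        ≤⟨ +-monoˡ-≤ q′ a≤K+t+1 ⟩
        # (member K) + (t + 1) + q′   ≡⟨ rearrange (# (member K)) t q′ ⟩
        # (member K) + (q + t)        ∎)
        where
        rearrange : ∀ k t q′ → k + (t + 1) + q′ ≡ k + (suc q′ + t)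
        rearrange = solve-∀

      module Crowded (noEscape : ¬ Escape) (noPair : ¬ Pair) where

        -- Without an escape, `z` has a neighbour in every accessible class other than its own,
        -- which leaves at most `r - (a - 1) = q` for `B`.
        degB-solo : ∀ z y → T (c z) ≡ true → B y ≡ true → solo y z ≡ true → deg adj B z ≤ q
        degB-solo z y Tz By yz = +-cancelˡ-≤ (# R′) _ _ (begin
          # R′ + deg adj B z
            ≤⟨ deg-bound R′ (λ j Rj → proj₁ (∧-true {R j} Rj)) z (T⇒A⇒X Tz) stuck ⟩
          r                     ≡⟨ sym a+q′≡r ⟩
          a + q′                ≤⟨ +-monoˡ-≤ q′ a≤R′+1 ⟩
          # R′ + 1 + q′         ≡⟨ +-assoc (# R′) 1 q′ ⟩
          # R′ + q              ∎)
          where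
          R′ : Fin d → Bool
          R′ j = R j ∧ not (c z == j)

          stuck : ∀ j → R′ j ≡ true → 1 ≤ nb adj c z j
          stuck j R′j with nb adj c z j in eq
          ... | suc _ = s≤s z≤n
          ... | zero  = contradiction
            (z , y , j , Tz , By , yz , proj₁ (∧-true {R j} R′j) ,
              ¬does⇒ (c z ≟ j) (not-true (proj₂ (∧-true {R j} R′j))) , eq) noEscape

          a≤R′+1 : a ≤ # R′ + 1
          a≤R′+1 = begin
            # R                                          ≤⟨ ∑-mono cover ⟩
            ∑ (λ j → χ (R′ j) + χ (c z == j))            ≡⟨ ∑-+ _ _ ⟩
            # R′ + ∑ (λ j → χ (c z == j))                ≡⟨ cong (# R′ +_) (∑-χ≡ (c z)) ⟩
            # R′ + 1                                     ∎
            where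
            cover : ∀ j → χ (R j) ≤ χ (R′ j) + χ (c z == j)
            cover j with R j | c z == j
            ... | false | _     = z≤n
            ... | true  | true  = ≤-refl
            ... | true  | false = ≤-refl

        -- Counting a solo vertex of W twice, every y in B sees a weight of at
        -- least 2 in W; if t ≤ q no vertex of W can receive more than 2q.
        q<t : q < t
        q<t with q <? t
        ... | yes lt = lt
        ... | no q≮t = ⊥-elim (crossCount 2 W w (s≤s z≤n) (T⇒R TW) lower upper)
          where
          W = proj₁ some
          TW = proj₂ some
          t≤q = ≮⇒≥ q≮t

          soloVertex? : ∀ z → Dec (∃ λ y → B y ≡ true × solo y z ≡ true)
          soloVertex? z = any? λ y → (B y ≟ᵇ true) ×-dec (solo y z ≟ᵇ true)

          w : Fin n → ℕ
          w z = if does (soloVertex? z) then 2 else 1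

          upper : ∀ z → c z ≡ W → w z * deg adj B z ≤ 2 * q
          upper z cz with soloVertex? z
          ... | yes (y , By , yz) = *-monoʳ-≤ 2 (degB-solo z y (trans (cong T cz) TW) By yz)
          ... | no _ = begin
            1 * deg adj B z     ≡⟨ *-identityˡ _ ⟩
            deg adj B z         ≤⟨ degB-T z (trans (cong T cz) TW) ⟩
            q + t               ≤⟨ +-monoʳ-≤ q t≤q ⟩
            q + q               ≡⟨ cong (q +_) (sym (+-identityʳ q)) ⟩
            2 * q               ∎

          1≤w : ∀ z → 1 ≤ w z
          1≤w z with does (soloVertex? z)
          ... | true  = s≤s z≤n
          ... | false = s≤s z≤n

          lower : ∀ y → B y ≡ true → 2 ≤ ∑ λ z → (χ (c z == W) * w z) * χ (adj y z)
          lower y By with nb adj c y W ≟ⁿ 1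
          ... | yes eq = begin
            2                                             ≡⟨ cong (2 *_) (sym eq) ⟩
            2 * nb adj c y W                              ≡⟨ cong (2 *_) (nb-∑ adj c y W) ⟩
            2 * ∑ (λ z → χ (c z == W) * χ (adj y z))      ≡⟨ *-∑ 2 _ ⟩
            ∑ (λ z → 2 * (χ (c z == W) * χ (adj y z)))    ≤⟨ ∑-mono heavy ⟩
            ∑ (λ z → (χ (c z == W) * w z) * χ (adj y z))  ∎
            where
            heavy : ∀ z → 2 * (χ (c z == W) * χ (adj y z)) ≤ (χ (c z == W) * w z) * χ (adj y z)
            heavy z with c z ≟ W | adj y z in yz
            ... | no _     | _     = z≤n
            ... | yes _    | false = z≤n
            ... | yes refl | true
              rewrite dec-true (soloVertex? z) (y , By , solo-intro yz eq) = ≤-refl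
          ... | no neq = begin
            2
              ≤⟨ ≤∧≢⇒< (nb≥1 By (T⇒R TW)) (λ eq → neq (sym eq)) ⟩
            nb adj c y W                                  ≡⟨ nb-∑ adj c y W ⟩
            ∑ (λ z → χ (c z == W) * χ (adj y z))
              ≤⟨ ∑-mono (λ z → *-monoˡ-≤ (χ (adj y z)) (begin
              χ (c z == W)            ≡⟨ sym (*-identityʳ _) ⟩
              χ (c z == W) * 1        ≤⟨ *-monoʳ-≤ (χ (c z == W)) (1≤w z) ⟩
              χ (c z == W) * w z      ∎)) ⟩
            ∑ (λ z → (χ (c z == W) * w z) * χ (adj y z))  ∎

        σ : Fin n → ℕ
        σ y = ∑ λ z → χ (T (c z)) * χ (solo y z)

        -- A class contains a solo neighbour of `y` exactly if `y` has exactly one neighbour there,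
        -- so the solo neighbours can be counted class by class.
        σ-∑ : ∀ y → σ y ≡ ∑ λ j → χ (T j) * χ (does (nb adj c y j ≟ⁿ 1))
        σ-∑ y = begin-equality
          ∑ (λ z → χ (T (c z)) * χ (solo y z))
            ≡⟨ ∑-cong (λ z → trans (cong (χ (T (c z)) *_) (χ-∧ (adj y z) _))
                                                                    (x∙yz≈xz∙y (χ (T (c z))) _ _)) ⟩
          ∑ (λ z → g (c z) * χ (adj y z))                      ≡⟨ ∑-fibre c g (λ z → χ (adj y z)) ⟩
          ∑ (λ j → g j * ∑ λ z → χ (c z == j) * χ (adj y z))
            ≡⟨ ∑-cong (λ j → cong (g j *_) (sym (nb-∑ adj c y j))) ⟩
          ∑ (λ j → g j * nb adj c y j)                         ≡⟨ ∑-cong absorb ⟩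
          ∑ g                                                  ∎
          where
          g : Fin d → ℕ
          g j = χ (T j) * χ (does (nb adj c y j ≟ⁿ 1))

          absorb : ∀ j → g j * nb adj c y j ≡ g j
          absorb j = cases (χ (T j)) (nb adj c y j)
            where
            cases : ∀ x k → x * χ (does (k ≟ⁿ 1)) * k ≡ x * χ (does (k ≟ⁿ 1))
            cases x 1 = *-identityʳ _
            cases x 0 = trans (*-zeroʳ (x * 0)) (sym (*-zeroʳ x))
            cases x (suc (suc k)) = trans (cong (_* suc (suc k)) (*-zeroʳ x)) (sym (*-zeroʳ x))

        -- Among its at most `r = a + q′` neighbours in `X`, `y` has one in each accessible class, a
        -- second one in each class of `T` that contains no solo neighbour of `y`, and in addition
        -- those in `B`.
        many-solo : ∀ y → B y ≡ true → t + suc (deg adj B y) ≤ σ y + q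
        many-solo y By = +-cancelˡ-≤ a _ _ (begin
          a + (t + suc (deg adj B y))        ≡⟨ rearrange a t (deg adj B y) ⟩
          suc (a + t + deg adj B y)          ≤⟨ s≤s (begin
            a + t + deg adj B y
              ≡⟨ cong (a + t +_) (deg-fibre adj c Bᶜ y) ⟩
            a + t + ∑ (λ j → χ (Bᶜ j) * N j)
              ≡⟨ cong (_+ ∑ (λ j → χ (Bᶜ j) * N j)) (sym (∑-+ _ _)) ⟩
            ∑ (λ j → χ (R j) + χ (T j)) + ∑ (λ j → χ (Bᶜ j) * N j)  ≡⟨ sym (∑-+ _ _) ⟩
            ∑ (λ j → χ (R j) + χ (T j) + χ (Bᶜ j) * N j)            ≤⟨ ∑-mono term ⟩
            ∑ (λ j → χ (C j) * N j + χ (T j) * χ (does (N j ≟ⁿ 1))) ≡⟨ ∑-+ _ _ ⟩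
            ∑ (λ j → χ (C j) * N j) + ∑ (λ j → χ (T j) * χ (does (N j ≟ⁿ 1)))
              ≤⟨ +-mono-≤ (∑nb≤r inside y (B⇒X By)) (≤-reflexive (sym (σ-∑ y))) ⟩
            r + σ y                                                 ∎) ⟩
          suc (r + σ y)                      ≡⟨ cong (λ x → suc (x + σ y)) (sym a+q′≡r) ⟩
          suc (a + q′ + σ y)                 ≡⟨ rearrange′ a q′ (σ y) ⟩
          a + (σ y + q)                      ∎)
          where
          N : Fin d → ℕ
          N = nb adj c y

          rearrange : ∀ a t e → a + (t + suc e) ≡ suc (a + t + e)
          rearrange = solve-∀

          rearrange′ : ∀ a q′ e → suc (a + q′ + e) ≡ a + (e + suc q′)
          rearrange′ = solve-∀

          term : ∀ j → χ (R j) + χ (T j) + χ (Bᶜ j) * N j ≤ χ (C j) * N j + χ (T j) * χ (does (N j ≟ⁿ 1))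
          term j = cases (C j) (R j) (not (member (U ∷ K) j)) (N j) R⇒C (nb≥1 By)
            where
            cases : ∀ x y z k → (y ≡ true → x ≡ true) → (y ≡ true → 1 ≤ k) →
              χ y + χ (y ∧ z) + χ (x ∧ not y) * k ≤ χ x * k + χ (y ∧ z) * χ (does (k ≟ⁿ 1))
            cases x false z k _ _ with x
            ... | true  = m≤m+n _ _
            ... | false = z≤n
            cases x true z zero _ f = contradiction (f refl) λ ()
            cases x true z (suc k) f _ rewrite f refl with z | k
            ... | false | _     = s≤s z≤n
            ... | true  | zero  = ≤-refl
            ... | true  | suc _ = s≤s (s≤s z≤n)

        -- Summing `many-solo` over a maximal independent set `I` of `B` gives many solo pairs,
        -- while without a `Pair` each vertex in a class of `T` is the solo neighbour of at most one
        -- vertex of `I`. As vertices of `B` have fewer than `q` neighbours in `B`, `I` has more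
        -- than `s` vertices, which is too many.
        crowded : ⊥
        crowded
          with I , I⊆B , ind , dom ← maximalIndependent adj adj-sym adj-irr B (List.allFin n)
          = impossible t q s (# I) (∑ λ y → χ (I y) * σ y) (# B) q<t qs<#B #B≤qI manySolo fewSolo
          where
          -- From `q s < b ≤ q i` follows `s < i`, whereas the last two bounds give
          -- `(t - q) i ≤ s t - b < (t - q) s`.
          impossible : ∀ t q s i σ b → q < t → q * s < b → b ≤ q * i → t * i + b ≤ σ + q * i → σ ≤ s * t → ⊥
          impossible t q s i σ b q<t qs<b b≤qi many few
            with e , refl ← m≤n⇒∃[o]m+o≡n q<t
            with f , refl ← m≤n⇒∃[o]m+o≡n (*-cancelˡ-< q s i (<-≤-trans qs<b b≤qi))
            = <⇒≱ (begin-strict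
              -- The slack added here is `(t - q)(i - s)`, as `t = q + 1 + e` and `i = s + 1 + f`.
              s * (suc q + e) + q * (suc s + f)                  ≤⟨ m≤m+n _ (suc e + f + e * f) ⟩
              s * (suc q + e) + q * (suc s + f) + (suc e + f + e * f) ≡⟨ expand q s e f ⟩
              (suc q + e) * (suc s + f) + q * s
                <⟨ +-monoʳ-< ((suc q + e) * (suc s + f)) qs<b ⟩
              (suc q + e) * (suc s + f) + b                      ∎)
              (≤-trans many (+-monoˡ-≤ (q * (suc s + f)) few))
            where
            expand : ∀ q s e f → s * (suc q + e) + q * (suc s + f) + (suc e + f + e * f) ≡ (suc q + e) * (suc s + f) + q * s
            expand = solve-∀

          E : ℕ
          E = ∑ λ y → χ (I y) * deg adj B y

          sumI : (f : Fin n → ℕ) → ∑ (λ y → χ (I y) * suc (f y)) ≡ # I + ∑ λ y → χ (I y) * f y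
          sumI f = trans (∑-cong λ y → *-suc (χ (I y)) (f y)) (∑-+ _ _)

          -- By maximality each vertex of `B` lies in `I` or has a neighbour in `I`; the edges
          -- between `B` and `I` are then counted from `I`.
          #B≤I+E : # B ≤ # I + E
          #B≤I+E = begin
            # B                                                    ≤⟨ ∑-mono dominated ⟩
            ∑ (λ v → χ (I v) + χ (B v) * deg adj I v)              ≡⟨ ∑-+ _ _ ⟩
            # I + ∑ (λ v → χ (B v) * deg adj I v)
              ≡⟨ cong (# I +_) (∑-cong λ v → cong (χ (B v) *_) (deg-∑ adj I v)) ⟩
            # I + ∑ (λ v → χ (B v) * ∑ λ w → χ (I w) * χ (adj v w))
              ≡⟨ cong (# I +_) (handshake adj adj-sym (λ v → χ (B v)) (λ w → χ (I w))) ⟩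
            # I + ∑ (λ w → χ (I w) * ∑ λ v → χ (B v) * χ (adj w v))
              ≡⟨ cong (# I +_) (∑-cong λ w → cong (χ (I w) *_) (sym (deg-∑ adj B w))) ⟩
            # I + E                                                ∎
            where
            dominated : ∀ v → χ (B v) ≤ χ (I v) + χ (B v) * deg adj I v
            dominated v with B v in Bv
            ... | false = z≤n
            ... | true  = subst (λ x → 1 ≤ χ (I v) + x) (sym (*-identityˡ _)) (dom v (∈-allFin v) Bv)

          #B≤qI : # B ≤ q * # I
          #B≤qI = begin
            # B                                         ≤⟨ #B≤I+E ⟩
            # I + E                                     ≡⟨ sym (sumI (deg adj B)) ⟩
            ∑ (λ y → χ (I y) * suc (deg adj B y))
              ≤⟨ ∑χ*-≤ I q (λ y Iy → s≤s (degB≤q′ y (I⊆B y Iy))) ⟩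
            q * # I                                     ∎

          manySolo : t * # I + # B ≤ ∑ (λ y → χ (I y) * σ y) + q * # I
          manySolo = begin
            t * # I + # B
              ≤⟨ +-monoʳ-≤ (t * # I) #B≤I+E ⟩
            t * # I + (# I + E)
              ≡⟨ cong₂ _+_ (*-∑I t) (sym (sumI (deg adj B))) ⟩
            ∑ (λ y → χ (I y) * t) + ∑ (λ y → χ (I y) * suc (deg adj B y)) ≡⟨ sym (∑*-+ _ _) ⟩
            ∑ (λ y → χ (I y) * (t + suc (deg adj B y)))
              ≤⟨ ∑-mono (λ y → χ*-mono {I y} λ Iy → many-solo y (I⊆B y Iy)) ⟩
            ∑ (λ y → χ (I y) * (σ y + q))                             ≡⟨ ∑*-+ _ _ ⟩
            ∑ (λ y → χ (I y) * σ y) + ∑ (λ y → χ (I y) * q)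
              ≡⟨ cong (∑ (λ y → χ (I y) * σ y) +_) (sym (*-∑I q)) ⟩
            ∑ (λ y → χ (I y) * σ y) + q * # I                         ∎
            where
            *-∑I : ∀ k → k * # I ≡ ∑ λ y → χ (I y) * k
            *-∑I k = trans (*-∑ k _) (∑-cong λ y → *-comm k (χ (I y)))

            ∑*-+ : (f g : Fin n → ℕ) → ∑ (λ y → χ (I y) * (f y + g y)) ≡ ∑ (λ y → χ (I y) * f y) + ∑ (λ y → χ (I y) * g y)
            ∑*-+ f g = trans (∑-cong λ y → *-distribˡ-+ (χ (I y)) (f y) (g y)) (∑-+ _ _)

          -- Distinct vertices of `I` are not adjacent, so with a common solo neighbour in a class
          -- of `T` they would form a `Pair`.
          fewSolo : ∑ (λ y → χ (I y) * σ y) ≤ s * t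
          fewSolo = begin
            ∑ (λ y → χ (I y) * σ y)
              ≡⟨ ∑-cong (λ y → *-∑ (χ (I y)) _) ⟩
            ∑ (λ y → ∑ λ z → χ (I y) * (χ (T (c z)) * χ (solo y z)))      ≡⟨ ∑-swap _ ⟩
            ∑ (λ z → ∑ λ y → χ (I y) * (χ (T (c z)) * χ (solo y z)))      ≤⟨ ∑-mono atMostOne ⟩
            # (λ z → T (c z))                                             ≡⟨ #-fibre c T ⟩
            ∑ (λ j → χ (T j) * size c j)
              ≤⟨ ∑χ*-≤ T s (λ j Tj → size-R≤s j (T⇒R Tj)) ⟩
            s * t                                                         ∎
            where
            atMostOne : ∀ z → ∑ (λ y → χ (I y) * (χ (T (c z)) * χ (solo y z))) ≤ χ (T (c z))
            atMostOne z = cases (T (c z) ≟ᵇ true)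
              where
              cases : Dec (T (c z) ≡ true) → ∑ (λ y → χ (I y) * (χ (T (c z)) * χ (solo y z))) ≤ χ (T (c z))
              cases (no ¬Tz) = subst (λ x → ∑ (λ y → χ (I y) * (χ x * χ (solo y z))) ≤ χ x) (sym (¬-not ¬Tz))
                (≤-reflexive (∑-zero λ y → *-zeroʳ (χ (I y))))
              cases (yes Tz) = subst (λ x → ∑ (λ y → χ (I y) * (χ x * χ (solo y z))) ≤ χ x) (sym Tz) (begin
                ∑ (λ y → χ (I y) * (1 * χ (solo y z)))
                  ≡⟨ ∑-cong (λ y → trans (cong (χ (I y) *_) (*-identityˡ _)) (sym (χ-∧ (I y) _))) ⟩
                # (λ y → I y ∧ solo y z)                  ≤⟨ #-unique _ same ⟩
                1                                         ∎)
                where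
                same : ∀ y₁ y₂ → I y₁ ∧ solo y₁ z ≡ true → I y₂ ∧ solo y₂ z ≡ true → y₁ ≡ y₂
                same y₁ y₂ p₁ p₂ with y₁ ≟ y₂ | ∧-true {I y₁} p₁ | ∧-true {I y₂} p₂
                ... | yes eq | _ | _ = eq
                ... | no neq | I₁ , s₁ | I₂ , s₂ = contradiction
                  (z , y₁ , y₂ , Tz , I⊆B y₁ I₁ , I⊆B y₂ I₂ , s₁ , s₂ , neq , ind y₁ y₂ I₁ I₂) noPair

    -- Exchanges between `B` and the accessible classes

    Progress : Set
    Progress = ∃ λ c′ → ∃ λ p′ → ∃ λ L′ → Valid c′ × Balanced m p′ c′ × Accessible adj c′ m L′ ×
      L′ ⊆ C × C p′ ≡ true × missing adj L′ < missing adj L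

    -- The surplus passes from `p` to `W`. Properness is recorded only within `B` without `y₁`,
    -- because `y₁` may clash with its neighbours in `W`.
    record Rebalanced (y₁ : Fin n) (W : Fin d) : Set where
      field
        g        : Fin n → Fin d
        g-in     : ∀ {v} → B v ≡ true → v ≢ y₁ → Bᶜ (g v) ≡ true
        g-y₁     : g y₁ ≡ W
        g-out    : ∀ {v} → B v ≡ false → g v ≡ c v
        g-bal    : Balance (size g) (size c) p W
        g-proper-B : ∀ u v → B u ≡ true → B v ≡ true → u ≢ y₁ → v ≢ y₁ → adj u v ≡ true → g u ≢ g v

    -- Move y₁ from B to the class W, put a vertex of the overfull class in its
    -- place, and recolour the rest of B by the induction hypothesis.
    module Rebalance (y₁ : Fin n) (W : Fin d) (By₁ : B y₁ ≡ true) (RW : R W ≡ true) where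

      c₁ c₂ : Fin n → Fin d
      c₁ = c [ v₀ ↦ c y₁ ]
      c₂ = c₁ [ y₁ ↦ W ]

      c₁y₁ : c₁ y₁ ≡ c y₁
      c₁y₁ with y₁ ≟ v₀
      ... | yes refl = ↦-same c v₀
      ... | no  neq  = ↦-other c neq

      bal₂ : Balance (size c₂) (size c) p W
      bal₂ = Balance-trans
        (subst (λ x → Balance (size c₂) (size c₁) x W) c₁y₁ (size-balance c₁ y₁ W))
        (subst (λ x → Balance (size c₁) (size c) x (c y₁)) cv₀ (size-balance c v₀ (c y₁)))

      X₂ : Fin n → Bool
      X₂ v = Bᶜ (c₂ v)

      ¬BᶜW : Bᶜ W ≡ false
      ¬BᶜW = ¬-not λ BW → true≢false RW (Bᶜ⇒¬R BW)

      X₂y₁ : X₂ y₁ ≡ false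
      X₂y₁ = trans (cong Bᶜ (↦-same c₁ y₁)) ¬BᶜW

      -- Only `y₁` leaves `B`: `v₀` merely changes to the class of `y₁`.
      X₂-other : ∀ {v} → v ≢ y₁ → X₂ v ≡ B v
      X₂-other {v} v≢y₁ = trans (cong Bᶜ (↦-other c₁ v≢y₁)) (rest (v ≟ v₀))
        where
        rest : Dec (v ≡ v₀) → Bᶜ (c₁ v) ≡ B v
        rest (yes refl) = trans (cong Bᶜ (↦-same c v₀)) (trans By₁ (sym Bv₀))
        rest (no  neq)  = cong Bᶜ (↦-other c neq)

      X₂⇒B : ∀ {v} → X₂ v ≡ true → B v ≡ true
      X₂⇒B {v} Xv = trans (sym (X₂-other λ { refl → true≢false Xv X₂y₁ })) Xv

      size₂ : ∀ i → Bᶜ i ≡ true → size c₂ i ≤ s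
      size₂ i Bi = m+n≤o⇒m≤o _ (begin
        size c₂ i + χ (m == i)   ≡⟨ Balance-trans bal₂ bal .at i ⟩
        size c₀ i + χ (W == i)
          ≡⟨ cong (λ x → size c₀ i + χ x) (dec-false (W ≟ i) λ { refl → true≢false RW (Bᶜ⇒¬R Bi) }) ⟩
        size c₀ i + 0            ≡⟨ +-identityʳ _ ⟩
        size c₀ i                ≤⟨ size≤s i (Bᶜ⇒C Bi) ⟩
        s                        ∎)

      -- The strict inequality `qs<#B` pays for the loss of `y₁`.
      big₂ : q * s ≤ # X₂
      big₂ = +-cancelʳ-≤ 1 _ _ (begin
        q * s + 1                                ≡⟨ +-comm (q * s) 1 ⟩
        suc (q * s)                              ≤⟨ qs<#B ⟩
        # B                                      ≤⟨ ∑-mono (λ v → cover v (y₁ ≟ v)) ⟩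
        ∑ (λ v → χ (X₂ v) + χ (y₁ == v))         ≡⟨ ∑-+ _ _ ⟩
        # X₂ + ∑ (λ v → χ (y₁ == v))             ≡⟨ cong (# X₂ +_) (∑-χ≡ y₁) ⟩
        # X₂ + 1                                 ∎)
        where
        cover : ∀ v → Dec (y₁ ≡ v) → χ (B v) ≤ χ (X₂ v) + χ (y₁ == v)
        cover v (yes refl) = ≤-trans (χ-mono λ _ → ==-refl v) (m≤n+m _ (χ (X₂ v)))
        cover v (no neq) = ≤-trans (≤-reflexive (cong χ (sym (X₂-other λ { refl → neq refl })))) (m≤m+n _ _)

      module IH-Colouring = Recolouring adj adj-sym adj-irr X₂ Bᶜ c₂

      rebalanced : IH-Colouring.Solution → Rebalanced y₁ W
      rebalanced (g , valid , sizes) = record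
        { g = g
        ; g-in = λ {v} Bv v≢y₁ → trans (G.inside v) (trans (X₂-other v≢y₁) Bv)
        ; g-y₁ = trans (G.fixed y₁ X₂y₁) (↦-same c₁ y₁)
        ; g-out = g-out
        ; g-bal = balance λ i → trans (cong (_+ χ (p == i)) (sizes i)) (bal₂ .at i)
        ; g-proper-B = λ u v Bu Bv u≢y₁ v≢y₁ → G.proper u v (trans (X₂-other u≢y₁) Bu) (trans (X₂-other v≢y₁) Bv)
        }
        where
        module G = IH-Colouring.Valid valid
        g-out : ∀ {v} → B v ≡ false → g v ≡ c v
        g-out {v} ¬Bv = trans (G.fixed v (trans (X₂-other v≢y₁) ¬Bv))
          (trans (↦-other c₁ v≢y₁) (↦-other c λ { refl → true≢false Bv₀ ¬Bv }))
          where
          v≢y₁ : v ≢ y₁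
          v≢y₁ refl = true≢false By₁ ¬Bv

      rebalance : Rebalanced y₁ W
      rebalance = rebalanced (IH q′ q′<r adj adj-sym adj-irr X₂ Bᶜ c₂ s (λ _ → refl) size₂ 1≤s big₂
        λ v Xv → ≤-trans (deg-mono adj λ _ → X₂⇒B) (degB≤q′ v (X₂⇒B Xv)))

    -- Once y₁ has joined the class W of its only neighbour z there, z is free to leave W.
    module Exchange (y₁ z : Fin n) (By₁ : B y₁ ≡ true) (Az : A z ≡ true) (y₁z : solo y₁ z ≡ true)
      (rebalanced : Rebalanced y₁ (c z)) where

      open Rebalanced rebalanced

      W : Fin d
      W = c z

      g-back : ∀ {v} → R (g v) ≡ true → g v ≢ W → B v ≡ false
      g-back {v} Rgv gv≢W with B v ≟ᵇ true
      ... | no ¬Bv = ¬-not ¬Bv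
      ... | yes Bv = contradiction (Bᶜ⇒¬R (g-in Bv λ { refl → gv≢W g-y₁ })) (true≢false Rgv)

      g-inside : Inside g
      g-inside v with B v ≟ᵇ true | v ≟ y₁
      ... | _      | yes refl = trans (cong C g-y₁) (trans (R⇒C Az) (sym (B⇒X By₁)))
      ... | yes Bv | no v≢y₁  = trans (Bᶜ⇒C (g-in Bv v≢y₁)) (sym (B⇒X Bv))
      ... | no ¬Bv | no _     = trans (cong C (g-out (¬-not ¬Bv))) (inside v)

      g-fixed : Fixed g
      g-fixed v ¬Xv = trans (g-out (¬-not λ Bv → true≢false (B⇒X Bv) ¬Xv)) (fixed v ¬Xv)

      A-or-B : ∀ {v} → X v ≡ true → A v ≡ true ⊎ B v ≡ true
      A-or-B {v} Xv = C-split (trans (inside v) Xv)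

      -- The vertices coloured `W` are `y₁` and old members of `W`, and among the latter `z` is the
      -- only neighbour of `y₁`.
      g-proper-y₁ : ∀ v → v ≢ z → X v ≡ true → adj y₁ v ≡ true → g v ≢ W
      g-proper-y₁ v v≢z Xv y₁v gv with v ≟ y₁
      ... | yes refl = true≢false y₁v (adj-irr y₁)
      ... | no v≢y₁ with A-or-B Xv
      ...   | inj₁ Av = v≢z (solo-unique y₁z y₁v (trans (sym (g-out (A⇒¬B Av))) gv))
      ...   | inj₂ Bv = true≢false (trans (cong R gv) Az) (Bᶜ⇒¬R (g-in Bv v≢y₁))

      g-A≢B : ∀ {u v} → A u ≡ true → B v ≡ true → v ≢ y₁ → g u ≢ g v
      g-A≢B Au Bv v≢y₁ eq = true≢false (trans (cong R (trans (sym eq) (g-out (A⇒¬B Au)))) Au) (Bᶜ⇒¬R (g-in Bv v≢y₁))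

      g-proper : ∀ u v → u ≢ z → v ≢ z → X u ≡ true → X v ≡ true → adj u v ≡ true → g u ≢ g v
      g-proper u v u≢z v≢z Xu Xv uv eq with u ≟ y₁ | v ≟ y₁
      ... | yes refl | _        = g-proper-y₁ v v≢z Xv uv (trans (sym eq) g-y₁)
      ... | no _     | yes refl = g-proper-y₁ u u≢z Xu (trans (adj-sym v u) uv) (trans eq g-y₁)
      ... | no u≢y₁  | no v≢y₁ with A-or-B Xu | A-or-B Xv
      ...   | inj₁ Au | inj₁ Av = proper u v Xu Xv uv (trans (sym (g-out (A⇒¬B Au))) (trans eq (g-out (A⇒¬B Av))))
      ...   | inj₁ Au | inj₂ Bv = g-A≢B Au Bv v≢y₁ eq
      ...   | inj₂ Bu | inj₁ Av = g-A≢B Av Bu u≢y₁ (sym eq)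
      ...   | inj₂ Bu | inj₂ Bv = g-proper-B u v Bu Bv u≢y₁ v≢y₁ uv eq

      module Leave (Y : Fin d) (CY : C Y ≡ true) (Y≢W : Y ≢ W) (free : Free adj g z Y) where

        g′ : Fin n → Fin d
        g′ = g [ z ↦ Y ]

        valid′ : Valid g′
        valid′ = place g-inside g-fixed g-proper (A⇒X Az) CY free

        -- The surplus has gone from `p` to `W` with the arrival of `y₁` and goes on to `Y` with
        -- `z`.
        bal′ : Balanced m Y g′
        bal′ = Balance-trans
          (Balance-trans
            (subst (λ x → Balance (size g′) (size g) x Y) (g-out (A⇒¬B Az)) (size-balance g z Y))
            g-bal)
          bal

        keep-A : ∀ {v} → v ≢ z → A v ≡ true → g′ v ≡ c v
        keep-A v≢z Av = trans (↦-other g v≢z) (g-out (A⇒¬B Av))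

        keep : ∀ {v} → A v ≡ true → c v ≢ W → g′ v ≡ c v
        keep Av cv≢W = keep-A (λ { refl → cv≢W refl }) Av

        keep′ : ∀ {v} → R (g′ v) ≡ true → g′ v ≢ W → g′ v ≢ Y → g′ v ≡ c v
        keep′ {v} Rg′v g′v≢W g′v≢Y = trans g′v (g-out (g-back (trans (cong R (sym g′v)) Rg′v) λ e → g′v≢W (trans g′v e)))
          where
          g′v : g′ v ≡ g v
          g′v = ↦-other g λ { refl → g′v≢Y (↦-same g z) }

    module Resolve (b : Blocking) (terminal : ∀ W → Blocking.T b W ≡ true → Terminal W) where
      open Blocking b
      open Counting b

      -- As the class `W` of `z` is terminal, a chain leads from `Y` to `m` without `W`. The
      -- exchange leaves it intact except that `Y` gains `z`, so the surplus now in `Y` can be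
      -- shifted to `m`.
      resolve-escape : ∀ {z y₁ Y} → T (c z) ≡ true → B y₁ ≡ true → solo y₁ z ≡ true → R Y ≡ true → c z ≢ Y →
        nb adj c z Y ≡ 0 → Rebalanced y₁ (c z) → Solution
      resolve-escape {z} {y₁} {Y} Tz By₁ y₁z RY W≢Y none rebalanced
        with L′ , acc′ , L′⊆ , ⊆L′ ← terminal (c z) Tz
        with L″ , acc″ , sub , _ ← suffix adj acc′ (⊆L′ Y (R⇒∈ RY) (λ Y≡W → W≢Y (sym Y≡W)))
        = shift (suc (length L″)) ≤-refl valid′ bal′ (λ i i∈ → L⊆C i (in-L i i∈))
            (transfer-head adj acc″
              (λ v cv∈ → keep (∈⇒R (in-L _ cv∈)) (proj₂ (L′⊆ _ (sub _ cv∈))))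
              (λ v g′v∈ → keep′ (∈⇒R (in-L _ (there g′v∈))) (proj₂ (L′⊆ _ (sub _ (there g′v∈))))
                λ { g′v≡Y → head∉ acc″ (subst (_∈ L″) g′v≡Y g′v∈) }))
        where
        open Exchange y₁ z By₁ (T⇒R Tz) y₁z rebalanced
        open Rebalanced rebalanced
        in-L : ∀ i → i ∈ Y ∷ L″ → i ∈ L
        in-L i i∈ = proj₁ (L′⊆ i (sub i i∈))

        free : Free adj g z Y
        free w zw gw≡Y = nb≡0⇒Free adj none w zw (trans (sym (g-out (g-back (trans (cong R gw≡Y) RY)
          λ gw≡W → W≢Y (trans (sym gw≡W) gw≡Y)))) gw≡Y)

        open Leave Y (R⇒C RY) (λ Y≡W → W≢Y (sym Y≡W)) free

      -- Without an escape, `z` can only go to an inaccessible class `Y`, which takes the surplus.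
      -- All classes of `L` stay accessible, and `y₂`, having lost its only neighbour in the class
      -- of `z`, can move there and so makes its own class accessible.
      resolve-pair : ∀ {z y₁ y₂} → ¬ Escape → T (c z) ≡ true → B y₁ ≡ true → B y₂ ≡ true →
        solo y₁ z ≡ true → solo y₂ z ≡ true → y₁ ≢ y₂ → adj y₁ y₂ ≡ false → Rebalanced y₁ (c z) → Progress
      resolve-pair {z} {y₁} {y₂} noEscape Tz By₁ By₂ y₁z y₂z y₁≢y₂ y₁y₂ rebalanced
        with L′ , acc′ , L′⊆ , ⊆L′ ← terminal (c z) Tz
        with Y , CY , free ← freeColour (Exchange.g-inside y₁ z By₁ (T⇒R Tz) y₁z rebalanced) z (T⇒A⇒X Tz)
        = g′ , Y , g′ y₂ ∷ W ∷ L′ , valid′ , bal′ , acc-y₂ , ⊆C , CY ,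
          missing-< adj L⊆ (g′ y₂) (λ ∈L → true≢false (∈⇒R ∈L) (Bᶜ⇒¬R Bg′y₂)) (here refl)
        where
        open Exchange y₁ z By₁ (T⇒R Tz) y₁z rebalanced
        open Rebalanced rebalanced

        stuck : ∀ j → R j ≡ true → W ≢ j → 1 ≤ nb adj c z j
        stuck j Rj W≢j with nb adj c z j in eq
        ... | suc _ = s≤s z≤n
        ... | zero  = contradiction (z , y₁ , j , Tz , By₁ , y₁z , Rj , W≢j , eq) noEscape

        Y≢W : Y ≢ W
        Y≢W refl = free y₁ (trans (adj-sym z y₁) (solo-adj y₁z)) g-y₁

        ¬RY : R Y ≢ true
        ¬RY RY with w , zw , cw ← 1≤nb⇒∃ adj (stuck Y RY λ W≡Y → Y≢W (sym W≡Y)) =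
          free w zw (trans (g-out (A⇒¬B (trans (cong R cw) RY))) cw)

        open Leave Y CY Y≢W free

        in-L′ : ∀ {v} → g′ v ∈ L′ → g′ v ≡ c v
        in-L′ g′v∈ = keep′ (∈⇒R (proj₁ (L′⊆ _ g′v∈))) (proj₂ (L′⊆ _ g′v∈))
          λ g′v≡Y → ¬RY (trans (cong R (sym g′v≡Y)) (∈⇒R (proj₁ (L′⊆ _ g′v∈))))

        acc-L′ : Accessible adj g′ m L′
        acc-L′ = transfer adj acc′ (λ v cv∈ → keep (∈⇒R (proj₁ (L′⊆ _ cv∈))) (proj₂ (L′⊆ _ cv∈))) (λ v → in-L′)

        W∉L′ : W ∉ L′
        W∉L′ W∈ = proj₂ (L′⊆ W W∈) refl

        -- The old witness `w` for `W` is not `z`, because `z` has a neighbour in every other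
        -- accessible class; so `w` is still in `W` and can still move to `j`.
        acc-W : Accessible adj g′ m (W ∷ L′)
        acc-W with suffix adj acc (R⇒∈ (T⇒R Tz))
        ... | _ , root , _ = contradiction refl (proj₂ (L′⊆ m (root∈ adj acc′)))
        ... | L₀ , grow {j = j} w cw wj j∈L₀ W∉L₀ _ , sub , _ =
          grow w (trans (keep-A w≢z (trans (cong R cw) (T⇒R Tz))) cw)
            (λ x wx g′x → wj x wx (trans (sym (in-L′ (subst (_∈ L′) (sym g′x) j∈L′))) g′x)) j∈L′ W∉L′ acc-L′
          where
          j≢W : j ≢ W
          j≢W refl = W∉L₀ j∈L₀

          j∈L : j ∈ L
          j∈L = sub j (there j∈L₀)

          j∈L′ : j ∈ L′
          j∈L′ = ⊆L′ j j∈L j≢W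

          w≢z : w ≢ z
          w≢z refl = 1≤nb⇒¬Free adj (stuck j (∈⇒R j∈L) λ W≡j → j≢W (sym W≡j)) wj

        y₂≢z : y₂ ≢ z
        y₂≢z refl = true≢false By₂ (A⇒¬B (T⇒R Tz))

        Bg′y₂ : Bᶜ (g′ y₂) ≡ true
        Bg′y₂ = trans (cong Bᶜ (↦-other g y₂≢z)) (g-in By₂ λ y₂≡y₁ → y₁≢y₂ (sym y₂≡y₁))

        -- Among the neighbours of `y₂`, only `z` was in `W`, and it has left; the newcomer `y₁` is
        -- not adjacent to `y₂`.
        free-y₂ : Free adj g′ y₂ W
        free-y₂ x y₂x g′x with x ≟ z | x ≟ y₁ | B x ≟ᵇ true
        ... | yes refl | _ | _ = Y≢W (trans (sym (↦-same g z)) g′x)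
        ... | no _ | yes refl | _ = true≢false y₂x (trans (adj-sym y₂ y₁) y₁y₂)
        ... | no x≢z | no x≢y₁ | yes Bx =
          true≢false (trans (cong R (trans (sym (↦-other g x≢z)) g′x)) (T⇒R Tz)) (Bᶜ⇒¬R (g-in Bx x≢y₁))
        ... | no x≢z | no _ | no ¬Bx =
          x≢z (solo-unique y₂z y₂x (trans (sym (g-out (¬-not ¬Bx))) (trans (sym (↦-other g x≢z)) g′x)))

        acc-y₂ : Accessible adj g′ m (g′ y₂ ∷ W ∷ L′)
        acc-y₂ = grow y₂ refl free-y₂ (here refl) notIn acc-W
          where
          notIn : g′ y₂ ∉ W ∷ L′
          notIn (here eq)  = true≢false (trans (cong R eq) (T⇒R Tz)) (Bᶜ⇒¬R Bg′y₂)
          notIn (there ∈L′) = true≢false (∈⇒R (proj₁ (L′⊆ _ ∈L′))) (Bᶜ⇒¬R Bg′y₂)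

        ⊆C : (g′ y₂ ∷ W ∷ L′) ⊆ C
        ⊆C _ (here refl)           = Bᶜ⇒C Bg′y₂
        ⊆C _ (there (here refl))   = R⇒C (T⇒R Tz)
        ⊆C i (there (there i∈L′)) = L⊆C i (proj₁ (L′⊆ i i∈L′))

        L⊆ : ∀ i → i ∈ L → i ∈ g′ y₂ ∷ W ∷ L′
        L⊆ i i∈L with i ≟ W
        ... | yes refl = there (here refl)
        ... | no i≢W   = there (there (⊆L′ i i∈L i≢W))

      resolve : Solution ⊎ Progress
      resolve with escape? | pair?
      ... | yes (z , y₁ , _ , Tz , By₁ , y₁z , RY , W≢Y , none) | _ =
        inj₁ (resolve-escape Tz By₁ y₁z RY W≢Y none (Rebalance.rebalance y₁ (c z) By₁ (T⇒R Tz)))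
      ... | no ¬e | yes (z , y₁ , _ , Tz , By₁ , By₂ , y₁z , y₂z , y₁≢y₂ , y₁y₂) =
        inj₂ (resolve-pair ¬e Tz By₁ By₂ y₁z y₂z y₁≢y₂ y₁y₂ (Rebalance.rebalance y₁ (c z) By₁ (T⇒R Tz)))
      ... | no ¬e | no ¬p = ⊥-elim (Crowded.crowded ¬e ¬p)

    unstick : Solution ⊎ Progress
    unstick with b , terminal ← minimal (suc (# (Blocking.T blocking))) blocking ≤-refl
      = Resolve.resolve b terminal

  -- Once the list is closed, either `p` is in it and `shift` finishes, or `unstick` yields a
  -- solution or strictly more accessible classes. In the last case `missing` has decreased.
  settle : ∀ k {c m p L} → missing adj L < k → Valid c → Balanced m p c → Accessible adj c m L →
    L ⊆ C → C p ≡ true → Solution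
  settle (suc k) {c} {m} {p} {L} (s≤s lt) valid bal acc L⊆C Cp
    with L₁ , acc₁ , sub , L₁⊆C , closed ← closure adj (suc (missing adj L)) c m C L ≤-refl acc L⊆C
    with p ∈? L₁
  ... | yes p∈L₁ with L₂ , acc₂ , sub₂ , _ ← suffix adj acc₁ p∈L₁ =
    shift (suc (length L₂)) ≤-refl valid bal (λ i i∈ → L₁⊆C i (sub₂ i i∈)) acc₂
  ... | no p∉L₁ with Stuck.unstick valid bal acc₁ L₁⊆C closed Cp p∉L₁
  ...   | inj₁ solution = solution
  ...   | inj₂ (_ , _ , _ , valid′ , bal′ , acc′ , L′⊆C , Cp′ , lt′) =
    settle k (<-≤-trans lt′ (≤-trans (missing-≤ adj sub) lt)) valid′ bal′ acc′ L′⊆C Cp′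

-- Activating the vertices one by one

deg-mono-adj : {adj adj′ : Fin n → Fin n → Bool} → (∀ u v → adj u v ≡ true → adj′ u v ≡ true) →
  ∀ P v → deg adj P v ≤ deg adj′ P v
deg-mono-adj {adj = adj} {adj′} sub P v = subst₂ _≤_ (sym (deg-∑ adj P v)) (sym (deg-∑ adj′ P v))
  (∑-mono λ w → *-monoʳ-≤ (χ (P w)) (χ-mono (sub v w)))

-- The edges are switched on vertex by vertex: after activating x, a free colour
-- for x creates at most one overfull and one underfull class, which settle repairs.
recolourable : ∀ r → Recolourable r n d
recolourable {n} {d} = <-rec _ λ r IH adj adj-sym adj-irr X C c₀ s inside₀ size≤s 1≤s big degX →
  let open Activation r (λ _ → IH) adj adj-sym adj-irr X C c₀ s inside₀ size≤s 1≤s big degX in solution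
  where
  module Activation (r : ℕ) (IH : ∀ r′ → r′ < r → Recolourable r′ n d)
    (adj : Fin n → Fin n → Bool)
    (adj-sym : ∀ u v → adj u v ≡ adj v u) (adj-irr : ∀ v → adj v v ≡ false)
    (X : Fin n → Bool) (C : Fin d → Bool) (c₀ : Fin n → Fin d) (s : ℕ)
    (inside₀ : ∀ v → C (c₀ v) ≡ X v) (size≤s : ∀ i → C i ≡ true → size c₀ i ≤ s)
    (1≤s : 1 ≤ s) (big : suc r * s ≤ # X) (degX : ∀ v → X v ≡ true → deg adj X v ≤ r) where

    active : List (Fin n) → Fin n → Fin n → Bool
    active vs u v = adj u v ∧ (member vs u ∧ member vs v)

    active⇒adj : ∀ {vs} u v → active vs u v ≡ true → adj u v ≡ true
    active⇒adj u v p = proj₁ (∧-true p)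

    active-sym : ∀ vs u v → active vs u v ≡ active vs v u
    active-sym vs u v = cong₂ _∧_ (adj-sym u v) (∧-comm (member vs u) (member vs v))

    active-irr : ∀ vs v → active vs v v ≡ false
    active-irr vs v = ¬-not λ p → true≢false (active⇒adj {vs} v v p) (adj-irr v)

    Colouring : List (Fin n) → Set
    Colouring vs = Recolouring.Solution (active vs) (active-sym vs) (active-irr vs) X C c₀

    member-tail : ∀ {x v vs} → member (x ∷ vs) v ≡ true → v ≢ x → member vs v ≡ true
    member-tail {x} {v} {vs} p v≢x with does⇒ (v ∈? (x ∷ vs)) p
    ... | here v≡x  = contradiction v≡x v≢x
    ... | there v∈ = dec-true (v ∈? vs) v∈

    active-tail : ∀ {x vs} u v → active (x ∷ vs) u v ≡ true → u ≢ x → v ≢ x → active vs u v ≡ true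
    active-tail {x} {vs} u v p u≢x v≢x with uv , q ← ∧-true {adj u v} p with pu , pv ← ∧-true {member (x ∷ vs) u} q =
      ∧-intro uv (∧-intro (member-tail {vs = vs} pu u≢x) (member-tail {vs = vs} pv v≢x))

    activate : ∀ x vs → Colouring vs → Colouring (x ∷ vs)
    activate x vs (c , valid , sizes) = extend (X x ≟ᵇ true)
      where
      open Recolouring (active (x ∷ vs)) (active-sym (x ∷ vs)) (active-irr (x ∷ vs)) X C c₀
      open Step IH (active (x ∷ vs)) (active-sym (x ∷ vs)) (active-irr (x ∷ vs)) X C c₀ s
        inside₀ size≤s 1≤s big
        (λ v Xv → ≤-trans (deg-mono-adj (active⇒adj {x ∷ vs}) X v) (degX v Xv))
      module V = Recolouring.Valid valid

      proper : ∀ u v → u ≢ x → v ≢ x → X u ≡ true → X v ≡ true → active (x ∷ vs) u v ≡ true → c u ≢ c v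
      proper u v u≢x v≢x Xu Xv uv = V.proper u v Xu Xv (active-tail {vs = vs} u v uv u≢x v≢x)

      extend : Dec (X x ≡ true) → Colouring (x ∷ vs)
      extend (no ¬Xx) = c , record { inside = V.inside ; fixed = V.fixed ; proper = λ u v Xu Xv →
        proper u v (λ { refl → ¬Xx Xu }) (λ { refl → ¬Xx Xv }) Xu Xv } , sizes
      extend (yes Xx) with j , Cj , free ← freeColour V.inside x Xx =
        -- `x` leaves `c x` for `j`, so `c x` is the class short of a vertex and `j` the one with
        -- the surplus.
        settle (suc (missing (active (x ∷ vs)) (c x ∷ []))) ≤-refl
          (place V.inside V.fixed proper Xx Cj free)
          (balance λ k → trans (size-balance c x j .at k) (cong (_+ χ (j == k)) (sizes k)))
          root (λ { _ (here refl) → trans (V.inside x) Xx }) Cj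

    colouring : ∀ vs → Colouring vs
    colouring []       = c₀ , record { inside = inside₀ ; fixed = λ _ _ → refl
                           ; proper = λ u v _ _ uv → contradiction (proj₂ (∧-true {adj u v} uv)) λ () } , λ _ → refl
    colouring (x ∷ vs) = activate x vs (colouring vs)

    solution : Recolouring.Solution adj adj-sym adj-irr X C c₀
    solution with c , valid , sizes ← colouring (List.allFin n) =
      c , record { inside = V.inside ; fixed = V.fixed ; proper = λ u v Xu Xv uv →
        V.proper u v Xu Xv (∧-intro uv (∧-intro (all u) (all v))) } , sizes
      where
      module V = Recolouring.Valid valid
      all : ∀ v → member (List.allFin n) v ≡ true
      all v = dec-true (v ∈? List.allFin n) (∈-allFin v)

-- From the Boolean form to the theorem

opaque
  unfolding ∑

  count-tabulate : {A : Set} {P : A → Set} (P? : ∀ x → Dec (P x)) (f : Fin n → A) →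
    count P? (tabulate f) ≡ # λ i → does (P? (f i))
  count-tabulate {n = zero}  P? f = refl
  count-tabulate {n = suc n} P? f with does (P? (f zero))
  ... | true  = cong suc (count-tabulate P? (f ∘ suc))
  ... | false = count-tabulate P? (f ∘ suc)

  #-all : # {n} (const true) ≡ n
  #-all {zero}  = refl
  #-all {suc n} = cong suc #-all

-- Consecutive blocks of vertices, chosen without regard to edges; they provide `c₀`.
blocks : (ns : Vec ℕ d) → ∃ λ (c : Fin (sum ns) → Fin d) → ∀ i → size c i ≡ lookup ns i
blocks []       = (λ ()) , λ ()
blocks (k ∷ ns) with c′ , sizes′ ← blocks ns = go k
  where
  go : ∀ k → ∃ λ (c : Fin (k + sum ns) → Fin _) → ∀ i → size c i ≡ lookup (k ∷ ns) i
  go zero = suc ∘ c′ , λ where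
    zero    → ∑-zero λ _ → refl
    (suc i) → sizes′ i
  go (suc k) with c , sizes ← go k = (λ { zero → zero ; (suc v) → c v }) , λ where
    zero    → trans (∑-suc _) (cong suc (sizes zero))
    (suc i) → trans (∑-suc _) (sizes (suc i))

degree≤maxDegree : (G : Graph n) (v : Fin n) → Graph.degree G v ≤ maxDegree G
degree≤maxDegree G v = All.lookup (xs≤max 0 _) (∈-toList⁺ (∈-map⁺ (Graph.degree G) (∈-allFin⁺ v)))

theorem1 : (r n : ℕ) (G : Graph n) → maxDegree G ≤ r →
    (d : ℕ) (ns : Vec ℕ d) →
    (∀ i → 0 < lookup ns i) →
    sum ns ≡ n →
    (∀ i → lookup ns i ≤ n / suc r) →
    ∃ λ (c : Fin n → Fin d) → IsPrescribedColoring G ns c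
-- Without colours there are no vertices. In the other case the first colour supplies
-- `1 ≤ n / suc r` through `pos zero`.
theorem1 r _ G Δ≤r zero    [] pos refl bound = (λ ()) , record { proper = λ { {()} } ; sizes = λ () }
theorem1 r n G Δ≤r (suc d) ns pos refl bound =
  prescribe (recolourable r adj adj-sym adj-irr (const true) (const true) c₀ (n / suc r)
    (λ _ → refl) (λ i _ → ≤-trans (≤-reflexive (sizes₀ i)) (bound i)) (≤-trans (pos zero) (bound zero))
    (≤-trans (≤-reflexive (*-comm (suc r) (n / suc r))) (≤-trans (m/n*n≤m n (suc r)) (≤-reflexive (sym #-all))))
    (λ v _ → degree≤r v))
  where
  c₀ : Fin n → Fin (suc d)
  c₀ = proj₁ (blocks ns)

  sizes₀ : ∀ i → size c₀ i ≡ lookup ns i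
  sizes₀ = proj₂ (blocks ns)

  adj : Fin n → Fin n → Bool
  adj u v = does (Graph.adj? G u v)

  adj-sym : ∀ u v → adj u v ≡ adj v u
  adj-sym u v = does-≡ (map′ (Graph.sym G) (Graph.sym G) (Graph.adj? G u v)) (Graph.adj? G v u)

  adj-irr : ∀ v → adj v v ≡ false
  adj-irr v = dec-false (Graph.adj? G v v) (Graph.irrefl G refl)

  degree≤r : ∀ v → deg adj (const true) v ≤ r
  degree≤r v = begin
    deg adj (const true) v         ≡⟨ deg-∑ adj (const true) v ⟩
    ∑ (λ w → 1 * χ (adj v w))      ≡⟨ ∑-cong (λ w → *-identityˡ _) ⟩
    # (adj v)                      ≡⟨ sym (count-tabulate (Graph.adj? G v) id) ⟩
    Graph.degree G v               ≤⟨ degree≤maxDegree G v ⟩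
    maxDegree G                    ≤⟨ Δ≤r ⟩
    r                              ∎
    where open ≤-Reasoning

  prescribe : Recolouring.Solution adj adj-sym adj-irr (const true) (const true) c₀ →
    ∃ λ (c : Fin n → Fin (suc d)) → IsPrescribedColoring G ns c
  prescribe (c , valid , sizes) = c , record
    { proper = λ {u} {v} uv → Recolouring.Valid.proper valid u v refl refl (dec-true (Graph.adj? G u v) uv)
    ; sizes  = λ i → trans (count-tabulate (λ v → c v ≟ i) id) (trans (sizes i) (sizes₀ i))
    }
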